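{- Let $\mathbf{w} = (1,1,w_2,\dots,w_{r+1})$ be a weight vector, $p$ a prime, $X$ a hypersurface of weighted degree $d$ in $\mathbb{P}_{\mathbb{Q}}(\mathbf{w})$ defined by an integral weighted homogeneous form, and $P$ an $\mathbb{F}_p$-point of multiplicity $m_P$ on $X_p$. Suppose $\boldsymbol\xi_1,\dots,\boldsymbol\xi_s$ are $s$ distinct primitive $(r+2)$-tuples of integers representing points of $X$, each reducing modulo $p$ to $P$, with $\gcd(\xi_{0,l},\xi_{1,l}) = 1$ for $1 \le l \le s$. Let $M_1,\dots,M_s$ be monomials in $x_0,\dots,x_{r+1}$ of the same weighted degree. Then there exists a positive number $\kappa(d,r)$, depending only on $d$ and $r$, such that the determinant of the $s\times s$ matrix $(M_j(\boldsymbol\xi_l))_{j,l}$ is divisible by $p^N$ for some integer $$N > \left(\frac{r!}{m_P}\right)^{1/r}\frac{r}{r+1}\, s^{1+1/r} - \kappa(d,r)s.$$ If $P$ is non-singular (so $m_P = 1$), then there exists a positive number $\kappa'(r)$, depending only on $r$, such that $N > (r!)^{1/r}\frac{r}{r+1}s^{1+1/r} - \kappa'(r)s$.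
   Context: $\mathbb{P}_{\mathbb{Q}}(\mathbf{w})$ denotes weighted projective space: nonzero vectors modulo $\mathbf{x}\sim(\lambda^{w_0}x_0,\dots,\lambda^{w_{r+1}}x_{r+1})$. The weighted degree of $x_0^{\beta_0}\cdots x_{r+1}^{\beta_{r+1}}$ is $\sum \beta_i w_i$. $X_p$ denotes the reduction of $X$ modulo $p$, and $X$ has dimension $r$. -}

module Defs where

open import Data.Nat as ℕ using (ℕ; zero; suc; _≤_; _<_)
open import Data.Nat.Combinatorics using (_C_)
open import Data.Integer as ℤ using (ℤ; +_; -_; ∣_∣)
open import Data.Integer.Divisibility using () renaming (_∣_ to _∣ℤ_)
open import Data.Fin using (Fin; zero; suc; punchIn; toℕ)
open import Data.List using (List; []; _∷_)
open import Data.Product using (_×_; _,_; Σ; ∃; ∃-syntax)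
open import Data.Sum using (_⊎_)
open import Relation.Binary.PropositionalEquality using (_≡_; _≢_)
open import Relation.Nullary using (¬_)
open import Data.Rational as ℚ using (ℚ)

Σℤ : ∀ n → (Fin n → ℤ) → ℤ
Σℤ zero    f = + 0
Σℤ (suc n) f = f zero ℤ.+ Σℤ n (λ i → f (suc i))

Πℤ : ∀ n → (Fin n → ℤ) → ℤ
Πℤ zero    f = + 1
Πℤ (suc n) f = f zero ℤ.* Πℤ n (λ i → f (suc i))

Σℕ : ∀ n → (Fin n → ℕ) → ℕ
Σℕ zero    f = 0
Σℕ (suc n) f = f zero ℕ.+ Σℕ n (λ i → f (suc i))

_^ℚ_ : ℚ → ℕ → ℚ
q ^ℚ zero  = ℚ.1ℚ
q ^ℚ suc k = q ℚ.* (q ^ℚ k)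

Exps : ℕ → Set
Exps n = Fin n → ℕ

wdeg : ∀ {n} → (Fin n → ℕ) → Exps n → ℕ
wdeg {n} w β = Σℕ n (λ i → β i ℕ.* w i)

tdeg : ∀ {n} → Exps n → ℕ
tdeg {n} α = Σℕ n α

monoEval : ∀ {n} → Exps n → (Fin n → ℤ) → ℤ
monoEval {n} β x = Πℤ n (λ i → x i ℤ.^ β i)

Poly : ℕ → Set
Poly n = List (ℤ × Exps n)

eval : ∀ {n} → Poly n → (Fin n → ℤ) → ℤ
eval []             x = + 0
eval ((c , β) ∷ f) x = c ℤ.* monoEval β x ℤ.+ eval f x

data WHomog {n} (w : Fin n → ℕ) (d : ℕ) : Poly n → Set where
  []  : WHomog w d []
  _∷_ : ∀ {c β f} → wdeg w β ≡ d → WHomog w d f → WHomog w d ((c , β) ∷ f)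

-- Hasse derivative D^α f evaluated at x, i.e. the coefficient of y^α in
-- the Taylor expansion f(x + y) = Σ_α (D^α f)(x) y^α:
--   D^α (x^β) = Π_i (β_i choose α_i) x_i^(β_i - α_i)
hasseEval : ∀ {n} → Poly n → Exps n → (Fin n → ℤ) → ℤ
hasseEval []             α x = + 0
hasseEval {n} ((c , β) ∷ f) α x =
  c ℤ.* Πℤ n (λ i → + (β i C α i) ℤ.* (x i ℤ.^ (β i ℕ.∸ α i)))
  ℤ.+ hasseEval f α x

_≡_[mod_] : ℤ → ℤ → ℕ → Set
a ≡ b [mod p ] = (+ p) ∣ℤ (a ℤ.- b)

Primitive : ∀ {n} → (Fin n → ℤ) → Set
Primitive x = ∀ (g : ℕ) → (∀ i → (+ g) ∣ℤ x i) → g ≡ 1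

ReducesTo : ∀ {n} → (Fin n → ℕ) → ℕ → (Fin n → ℤ) → (Fin n → ℤ) → Set
ReducesTo w p ξ P =
  ∃[ λ' ] (¬ (λ' ≡ + 0 [mod p ]) × (∀ i → ξ i ≡ (λ' ℤ.^ w i) ℤ.* P i [mod p ]))

FpPoint : ∀ {n} → ℕ → (Fin n → ℤ) → Set
FpPoint p P = ∃[ i ] ¬ (P i ≡ + 0 [mod p ])

-- Multiplicity of the point P on X_p = {f ≡ 0 mod p} ⊂ P_{F_p}(w),
-- w = (1,1,w_2,...).  P lies in a standard affine chart {x_k ≠ 0},
-- k ∈ {0,1}; since w_k = 1 that chart is affine space with coordinates
-- (x_i)_{i ≠ k} (after normalising x_k = P_k, a weighted rescaling of the
-- chart x_k = 1).  m_P is the order of vanishing at P of the local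
-- equation: the smallest |α| (α_k = 0) with nonzero Taylor coefficient
-- (D^α f)(P) in F_p.

chart : ∀ {r} → Fin 2 → Fin (suc (suc r))
chart zero    = zero
chart (suc _) = suc zero

IsMultiplicity : ∀ {r} → Poly (suc (suc r)) → ℕ → (Fin (suc (suc r)) → ℤ) → ℕ → Set
IsMultiplicity {r} f p P m =
  Σ (Fin 2) λ k →
    ¬ (P (chart k) ≡ + 0 [mod p ]) ×
    (∀ (α : Exps (suc (suc r))) → α (chart k) ≡ 0 → tdeg α < m →
        hasseEval f α P ≡ + 0 [mod p ]) ×
    (∃[ α ] (α (chart k) ≡ 0 × tdeg α ≡ m × ¬ (hasseEval f α P ≡ + 0 [mod p ])))

det : ∀ n → (Fin n → Fin n → ℤ) → ℤ
det zero    A = + 1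
det (suc n) A = Σℤ (suc n) λ j →
  ((- + 1) ℤ.^ toℕ j) ℤ.* A zero j ℤ.* det n (λ i k → A (suc i) (punchIn j k))

{-# OPTIONS --safe #-}

-- Work with values modulo powers of p.  After the weighted rescaling by ν = ξ_j / P_j the points have the
-- form P + p y, and the equation of X becomes a polynomial relation in z = p y whose coefficients of
-- degree < m_P are divisible by p.  Its leading monomial z^α₀ among the unit coefficients has |α₀| ≤ m_P, so
-- modulo p^k every function is a combination of the z^β with |β| < k that α₀ does not divide.  Hence the rows
-- of the determinant lie in the lattice spanned by the vectors p^|β| y^β and by p^k ℤ^s, and multilinearity
-- shows that p^N divides the determinant as soon as N + Σ_β (k - |β|) ≤ k s.  The sum is at most
-- m_P C(k + r, r + 1), and the choice C(k + r - 1, r) ≤ s / m_P < C(k + r, r) gives the bound with κ = r.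
module Submission where

open import Defs
open import Data.Fin using (Fin; zero; suc; punchIn)
open import Data.List using (List; []; _∷_)
open import Data.List.Membership.Propositional using (_∈_)
open import Data.Product using (_×_; _,_; proj₁; proj₂; ∃-syntax)
open import Data.Sum using (_⊎_; inj₁; inj₂)
open import Function using (_∘_)
open import Relation.Nullary using (Dec; yes; no; ¬_; contradiction)
open import Relation.Binary.PropositionalEquality

-- All computations are with integers modulo a fixed power of `p`: units are inverted there, so no
-- completion and no implicit function theorem is needed, and singular points are treated like
-- non-singular ones. Eliminating z^α₀ is not plain division with remainder. The relation may also
-- contain lighter monomials, whose coefficients are divisible by `p`, so a substitution can lower
-- the degree. It then gains a factor `p`, and at most k such gains matter modulo p^k. Between two
-- gains the weight grows, until the degree reaches k and z = p y makes the monomial vanish modulo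
-- p^k. In the determinant a generator p^a u can be used in one row only, because a repetition of u
-- gives zero. So it costs at most k - a once, however many rows involve it. Origin of κ: since (r +
-- 1) C(k + r, r + 1) = (k + r) C(k + r - 1, r), the loss m_P C(k + r, r + 1) is at most (k + r) s /
-- (r + 1). On the other side, r! C(k + r, r) ≤ (k + r)^r bounds k + r, not k, from below. Adding r
-- s to N turns k s into (k + r) s and makes the two fit; the degree d does not enter.

-- Alternating multilinear forms, the determinant, and divisibility on lattices.

module AlternatingForms where

  open import Data.Nat as ℕ using (ℕ; zero; suc)
  import Data.Nat.Properties as ℕₚ
  open import Data.Nat.Tactic.RingSolver using () renaming (solve-∀ to ℕ-solve-∀)
  open import Data.Integer as ℤ using (ℤ; +_; -_; ∣_∣; _+_; _*_; _^_; 0ℤ; 1ℤ)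
  import Data.Integer.Properties as ℤₚ
  open import Data.Integer.Divisibility.Signed as ℤ∣ using (_∣_; divides)
  open import Data.Integer.Tactic.RingSolver using (solve-∀)
  open import Data.Fin using (lift; toℕ)
  open import Data.Vec using (Vec; []; _∷_; lookup)
  open import Data.Vec.Relation.Unary.All using (All; []; _∷_)
  open import Data.Vec.Relation.Binary.Pointwise.Inductive using (Pointwise; []; _∷_)
  open import Data.Unit using (⊤; tt)

  Σ-cong : ∀ n {f g : Fin n → ℤ} → (∀ i → f i ≡ g i) → Σℤ n f ≡ Σℤ n g
  Σ-cong zero    eq = refl
  Σ-cong (suc n) eq = cong₂ _+_ (eq zero) (Σ-cong n (eq ∘ suc))

  Σ-zero : ∀ n {f : Fin n → ℤ} → (∀ i → f i ≡ 0ℤ) → Σℤ n f ≡ 0ℤ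
  Σ-zero zero    eq = refl
  Σ-zero (suc n) eq = cong₂ _+_ (eq zero) (Σ-zero n (eq ∘ suc))

  Σ-linear : ∀ n c (f g : Fin n → ℤ) → Σℤ n (λ i → f i + c * g i) ≡ Σℤ n f + c * Σℤ n g
  Σ-linear zero    c f g = sym (trans (ℤₚ.+-identityˡ _) (ℤₚ.*-zeroʳ c))
  Σ-linear (suc n) c f g = trans (cong (λ h → f zero + c * g zero + h) (Σ-linear n c (f ∘ suc) (g ∘ suc)))
                                 (rearrange (f zero) c (g zero) _ _)
    where
    rearrange : ∀ a c b x y → a + c * b + (x + c * y) ≡ a + x + c * (b + y)
    rearrange = solve-∀

  Row : ℕ → Set
  Row s = Fin s → ℤ

  Form : ℕ → ℕ → Set
  Form s q = Vec (Row s) q → ℤ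

  -- The combination is a separate row `z` with a pointwise equation, since rows are functions and
  -- pointwise equal rows need not be propositionally equal.
  Linear : ∀ {s q} → Form s (suc q) → Set
  Linear D = ∀ c x y z vs → (∀ l → z l ≡ x l + c * y l) → D (z ∷ vs) ≡ D (x ∷ vs) + c * D (y ∷ vs)

  Adjacent : ∀ {s} q → Form s (suc q) → Set
  Adjacent zero    D = ⊤
  Adjacent (suc q) D = ∀ x vs → D (x ∷ x ∷ vs) ≡ 0ℤ

  -- Fixing the first row leaves an alternating form in the others, so the condition on the first
  -- two rows, imposed at every depth, reaches all pairs of consecutive rows.
  data Alternating {s} : ∀ q → Form s q → Set where
    nil  : ∀ {D} → Alternating zero D
    cons : ∀ {q D} → Linear D → (∀ x → Alternating q (D ∘ (x ∷_))) → Adjacent q D → Alternating (suc q) D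

  Σ-alternating : ∀ {s} q n (a : Fin n → ℤ) {E : Fin n → Form s q} →
    (∀ j → Alternating q (E j)) → Alternating q (λ vs → Σℤ n (λ j → a j * E j vs))
  Σ-alternating zero n a alt = nil
  Σ-alternating {s} (suc q) n a {E} alt = cons linear tails (adjacent q alt)
    where
    linear : Linear (λ vs → Σℤ n (λ j → a j * E j vs))
    linear c x y z vs eq = trans (Σ-cong n step) (Σ-linear n c _ _)
      where
      rearrange : ∀ a c d e → a * (d + c * e) ≡ a * d + c * (a * e)
      rearrange = solve-∀
      step : ∀ j → a j * E j (z ∷ vs) ≡ a j * E j (x ∷ vs) + c * (a j * E j (y ∷ vs))
      step j with cons lin _ _ ← alt j =
        trans (cong (a j *_) (lin c x y z vs eq)) (rearrange (a j) c _ _)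
    tails : ∀ x → Alternating q (λ vs → Σℤ n (λ j → a j * E j (x ∷ vs)))
    tails x = Σ-alternating q n a λ j → tail (alt j) x
      where
      tail : ∀ {D} → Alternating (suc q) D → ∀ x → Alternating q (D ∘ (x ∷_))
      tail (cons _ t _) = t
    adjacent : ∀ q {E : Fin n → Form s (suc q)} → (∀ j → Alternating (suc q) (E j)) →
               Adjacent q (λ vs → Σℤ n (λ j → a j * E j vs))
    adjacent zero    alt = tt
    adjacent (suc q) alt x vs = Σ-zero n step
      where
      step : ∀ j → _ ≡ 0ℤ
      step j with cons _ _ adj ← alt j = trans (cong (a j *_) (adj x vs)) (ℤₚ.*-zeroʳ (a j))

  lift-cong : ∀ {m n} {ψ χ : Fin m → Fin n} → (∀ i → ψ i ≡ χ i) → ∀ i → lift 1 ψ i ≡ lift 1 χ i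
  lift-cong eq zero    = refl
  lift-cong eq (suc i) = cong suc (eq i)

  sgn : ∀ {n} → Fin n → ℤ
  sgn j = (- + 1) ^ toℕ j

  -- The columns deleted by two successive Laplace expansions form an ordered
  -- pair; exchanging the pair flips the sign.
  two-equal-rows : ∀ m (x : Fin (2 ℕ.+ m) → ℤ) (G : (Fin m → Fin (2 ℕ.+ m)) → ℤ) →
    (∀ {ψ χ} → (∀ i → ψ i ≡ χ i) → G ψ ≡ G χ) →
    Σℤ (2 ℕ.+ m) (λ j → sgn j * x j *
      Σℤ (1 ℕ.+ m) (λ k → sgn k * x (punchIn j k) * G (punchIn j ∘ punchIn k))) ≡ 0ℤ
  two-equal-rows m x G ext = begin
    1ℤ * x₀ * Σℤ (suc m) t + Σℤ (suc m) (λ j → - + 1 * sgn j * x (suc j) * (1ℤ * x₀ * G (punchIn (suc j) ∘ suc) + inner j))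
      ≡⟨ cong (λ h → 1ℤ * x₀ * Σℤ (suc m) t + h)
           (trans (Σ-cong (suc m) split) (Σ-linear (suc m) (- x₀) (λ j → - (sgn j * x (suc j) * inner j)) t)) ⟩
    1ℤ * x₀ * Σℤ (suc m) t + (Σℤ (suc m) (λ j → - (sgn j * x (suc j) * inner j)) + - x₀ * Σℤ (suc m) t)
      ≡⟨ cong (λ r → 1ℤ * x₀ * Σℤ (suc m) t + (r + - x₀ * Σℤ (suc m) t)) (rest m x G ext) ⟩
    1ℤ * x₀ * Σℤ (suc m) t + (0ℤ + - x₀ * Σℤ (suc m) t)
      ≡⟨ cancel x₀ (Σℤ (suc m) t) ⟩
    0ℤ ∎
    where
    open ≡-Reasoning
    x₀ = x zero
    t : Fin (suc m) → ℤ
    t k = sgn k * x (suc k) * G (suc ∘ punchIn k)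
    inner : Fin (suc m) → ℤ
    inner j = Σℤ m (λ k → - + 1 * sgn k * x (suc (punchIn j k)) * G (punchIn (suc j) ∘ punchIn (suc k)))
    cancel : ∀ a b → 1ℤ * a * b + (0ℤ + - a * b) ≡ 0ℤ
    cancel = solve-∀
    rearrange : ∀ s y a g i → - + 1 * s * y * (1ℤ * a * g + i) ≡ - (s * y * i) + - a * (s * y * g)
    rearrange = solve-∀
    split : ∀ j → - + 1 * sgn j * x (suc j) * (1ℤ * x₀ * G (punchIn (suc j) ∘ suc) + inner j) ≡
                  - (sgn j * x (suc j) * inner j) + - x₀ * t j
    split j = rearrange (sgn j) (x (suc j)) x₀ (G (suc ∘ punchIn j)) (inner j)
    -- The pairs that contain column 0 have cancelled. The others give the same double sum with one
    -- column fewer: the two sign changes compensate, and `lift 1` records that column 0 now stays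
    -- in every minor.
    rest : ∀ m (x : Fin (2 ℕ.+ m) → ℤ) (G : (Fin m → Fin (2 ℕ.+ m)) → ℤ) →
      (∀ {ψ χ} → (∀ i → ψ i ≡ χ i) → G ψ ≡ G χ) →
      Σℤ (suc m) (λ j → - (sgn j * x (suc j) *
        Σℤ m (λ k → - + 1 * sgn k * x (suc (punchIn j k)) * G (punchIn (suc j) ∘ punchIn (suc k))))) ≡ 0ℤ
    rest zero    x G ext = vanish (x (suc zero))
      where
      vanish : ∀ a → - (1ℤ * a * 0ℤ) + 0ℤ ≡ 0ℤ
      vanish = solve-∀
    rest (suc m) x G ext = trans (Σ-cong (suc (suc m)) λ j →
        trans (cong (λ i → - (sgn j * x (suc j) * i))
          (trans (Σ-cong (suc m) λ k → trans (cong (- + 1 * sgn k * x (suc (punchIn j k)) *_) (ext (lifted j k)))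
                                             (neg (sgn k) (x (suc (punchIn j k))) (G (lift 1 (punchIn j ∘ punchIn k)))))
                 (Σ-linear (suc m) (- + 1) (λ _ → 0ℤ)
                   (λ k → sgn k * x (suc (punchIn j k)) * G (lift 1 (punchIn j ∘ punchIn k))))))
          (trans (cong (λ z → - (sgn j * x (suc j) * (z + - + 1 * I j))) (Σ-zero (suc m) {λ _ → 0ℤ} (λ _ → refl)))
                 (neg₂ (sgn j) (x (suc j)) (I j))))
        (two-equal-rows m (x ∘ suc) (G ∘ lift 1) (λ eq → ext (lift-cong eq)))
      where
      I : Fin (suc (suc m)) → ℤ
      I j = Σℤ (suc m) (λ k → sgn k * x (suc (punchIn j k)) * G (lift 1 (punchIn j ∘ punchIn k)))
      lifted : ∀ j k i → punchIn (suc j) (punchIn (suc k) i) ≡ lift 1 (punchIn j ∘ punchIn k) i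
      lifted j k zero    = refl
      lifted j k (suc i) = refl
      neg : ∀ s y g → - + 1 * s * y * g ≡ 0ℤ + - + 1 * (s * y * g)
      neg = solve-∀
      neg₂ : ∀ s y i → - (s * y * (0ℤ + - + 1 * i)) ≡ s * y * i
      neg₂ = solve-∀

  det-cong : ∀ n {A B : Fin n → Fin n → ℤ} → (∀ i k → A i k ≡ B i k) → det n A ≡ det n B
  det-cong zero    eq = refl
  det-cong (suc n) eq = Σ-cong (suc n) λ j →
    cong₂ _*_ (cong (sgn j *_) (eq zero j)) (det-cong n λ i k → eq (suc i) (punchIn j k))

  -- The column selection `ϕ` makes a minor again a form on rows of full length `s`, so Laplace
  -- expansion stays within the induction.
  det-alternating : ∀ {s} q (ϕ : Fin q → Fin s) →
    Alternating q (λ vs → det q (λ i k → lookup vs i (ϕ k)))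
  det-alternating zero    ϕ = nil
  det-alternating {s} (suc q) ϕ = cons linear tails (adjacent q ϕ)
    where
    minor : Fin (suc q) → Form s q
    minor j vs = det q (λ i k → lookup vs i (ϕ (punchIn j k)))
    rearrange : ∀ a x c y d → a * (x + c * y) * d ≡ a * x * d + c * (a * y * d)
    rearrange = solve-∀
    linear : Linear {s} (λ vs → det (suc q) (λ i k → lookup vs i (ϕ k)))
    linear c x y z vs eq = trans (Σ-cong (suc q) λ j →
        trans (cong (λ h → sgn j * h * minor j vs) (eq (ϕ j))) (rearrange (sgn j) (x (ϕ j)) c (y (ϕ j)) (minor j vs)))
      (Σ-linear (suc q) c (λ j → sgn j * x (ϕ j) * minor j vs) (λ j → sgn j * y (ϕ j) * minor j vs))
    tails : ∀ x → Alternating q (λ vs → Σℤ (suc q) (λ j → sgn j * x (ϕ j) * minor j vs))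
    tails x = Σ-alternating q (suc q) (λ j → sgn j * x (ϕ j)) λ j → det-alternating q (ϕ ∘ punchIn j)
    adjacent : ∀ q (ϕ : Fin (suc q) → Fin s) → Adjacent {s} q (λ vs → det (suc q) (λ i k → lookup vs i (ϕ k)))
    adjacent zero    ϕ = tt
    adjacent (suc q) ϕ x vs = two-equal-rows q (x ∘ ϕ) (λ ψ → det q (λ i k → lookup vs i (ϕ (ψ k))))
      λ eq → det-cong q λ i k → cong (lookup vs i ∘ ϕ) (eq k)

  -- Polarisation: expand the form at the sum `w` of the two rows, placed in both positions.
  swap : ∀ {s q} {D : Form s (2 ℕ.+ q)} → Alternating (2 ℕ.+ q) D →
    ∀ x y vs → D (x ∷ y ∷ vs) ≡ - D (y ∷ x ∷ vs)
  swap {q = q} {D = D} (cons lin tail adj) x y vs = isolate _ _ (begin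
    D (x ∷ y ∷ vs) + D (y ∷ x ∷ vs)
      ≡⟨ unit (D (x ∷ y ∷ vs)) (D (y ∷ x ∷ vs)) ⟩
    (0ℤ + 1ℤ * D (x ∷ y ∷ vs)) + 1ℤ * (D (y ∷ x ∷ vs) + 1ℤ * 0ℤ)
      ≡⟨ cong₂ (λ a b → (a + 1ℤ * D (x ∷ y ∷ vs)) + 1ℤ * (D (y ∷ x ∷ vs) + 1ℤ * b)) (adj x vs) (adj y vs) ⟨
    (D (x ∷ x ∷ vs) + 1ℤ * D (x ∷ y ∷ vs)) + 1ℤ * (D (y ∷ x ∷ vs) + 1ℤ * D (y ∷ y ∷ vs))
      ≡⟨ cong₂ (λ a b → a + 1ℤ * b) (second x) (second y) ⟨
    D (x ∷ w ∷ vs) + 1ℤ * D (y ∷ w ∷ vs)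
      ≡⟨ lin 1ℤ x y w (w ∷ vs) (λ _ → refl) ⟨
    D (w ∷ w ∷ vs)
      ≡⟨ adj w vs ⟩
    0ℤ ∎)
    where
    open ≡-Reasoning
    w = λ l → x l + 1ℤ * y l
    second : ∀ v → D (v ∷ w ∷ vs) ≡ D (v ∷ x ∷ vs) + 1ℤ * D (v ∷ y ∷ vs)
    second v with cons lin′ _ _ ← tail v = lin′ 1ℤ x y w vs (λ _ → refl)
    unit : ∀ a b → a + b ≡ (0ℤ + 1ℤ * a) + 1ℤ * (b + 1ℤ * 0ℤ)
    unit = solve-∀
    isolate : ∀ a b → a + b ≡ 0ℤ → a ≡ - b
    isolate a b eq = trans (shift a b) (trans (cong (_+ - b) eq) (ℤₚ.+-identityˡ (- b)))
      where
      shift : ∀ a b → a ≡ a + b + - b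
      shift = solve-∀

  Shift : ∀ {s} → ℤ → Row s → Row s → Row s → Set
  Shift t u x x′ = ∃[ c ] (∀ l → x l ≡ x′ l + c * t * u l)

  -- A multiple of `u` added to another row contributes a form with `u` twice. After the second row
  -- is treated, it is moved to the front so that `u` stands next to the remaining rows.
  absorb : ∀ {s q t u} {D : Form s (suc q)} → Alternating (suc q) D →
    ∀ {vs vs′} → Pointwise (Shift t u) vs vs′ → D (u ∷ vs) ≡ D (u ∷ vs′)
  absorb alt [] = refl
  absorb {t = t} {u} {D} alt@(cons _ tail adj) {x ∷ vs} {x′ ∷ vs′} ((c , eq) ∷ shifts) = begin
    D (u ∷ x ∷ vs)                              ≡⟨ second ⟩
    D (u ∷ x′ ∷ vs) + c * t * D (u ∷ u ∷ vs)    ≡⟨ cong (λ h → D (u ∷ x′ ∷ vs) + c * t * h) (adj u vs) ⟩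
    D (u ∷ x′ ∷ vs) + c * t * 0ℤ                ≡⟨ drop _ (c * t) ⟩
    D (u ∷ x′ ∷ vs)                             ≡⟨ swap alt u x′ vs ⟩
    - D (x′ ∷ u ∷ vs)                           ≡⟨ cong -_ (absorb (tail x′) shifts) ⟩
    - D (x′ ∷ u ∷ vs′)                          ≡⟨ swap alt u x′ vs′ ⟨
    D (u ∷ x′ ∷ vs′)                            ∎
    where
    open ≡-Reasoning
    second : D (u ∷ x ∷ vs) ≡ D (u ∷ x′ ∷ vs) + c * t * D (u ∷ u ∷ vs)
    second with cons lin _ _ ← tail u = lin (c * t) x′ u x vs eq
    drop : ∀ a b → a + b * 0ℤ ≡ a
    drop = solve-∀

  -- Only `u` in the first row is considered: any other position differs from it by swaps, hence by
  -- a sign.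
  MinorsDivisible : ∀ {s} → ℤ → ℤ → Row s → (Row s → Set) → ∀ q → Form s q → Set
  MinorsDivisible n t u L zero    D = ⊤
  MinorsDivisible n t u L (suc q) D = ∀ ws → All L ws → n ∣ t * D (u ∷ ws)

  -- Expanding all rows x = x′ + c t u leaves the form at the rows x′ and terms with a single `u`.
  -- In such a term `absorb` replaces the remaining rows by their reduced versions, so `u` leaves
  -- the problem altogether.
  expand : ∀ {s n t u} {L : Row s → Set} q {D : Form s q} → Alternating q D →
    ∀ {vs vs′} → Pointwise (Shift t u) vs vs′ → All L vs′ →
    n ∣ D vs′ → MinorsDivisible n t u L q D → n ∣ D vs
  expand zero    alt [] [] main minors = main
  expand {n = n} {t} {u} {L} (suc q) {D} alt@(cons lin tail _) {x ∷ vs} {x′ ∷ vs′} ((c , eq) ∷ shifts) (L-x′ ∷ L-vs′) main minors =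
    subst (n ∣_) (sym (lin (c * t) x′ u x vs eq))
      (ℤ∣.∣m∣n⇒∣m+n (expand q (tail x′) shifts L-vs′ main (minors′ q alt minors))
        (subst (n ∣_) (trans (sym (ℤₚ.*-assoc c t _)) (cong (c * t *_) (sym (absorb alt shifts))))
          (ℤ∣.∣n⇒∣m*n c (minors vs′ L-vs′))))
    where
    move : ∀ t a → - (t * a) ≡ t * - a
    move = solve-∀
    minors′ : ∀ q {D : Form _ (suc q)} → Alternating (suc q) D → MinorsDivisible n t u L (suc q) D →
              MinorsDivisible n t u L q (D ∘ (x′ ∷_))
    minors′ zero    _ _ = tt
    minors′ (suc q) alt minors ws L-ws = subst (n ∣_) (trans (move t _) (cong (t *_) (sym (swap alt x′ u ws))))
      (ℤ∣.∣m⇒∣-m (minors (x′ ∷ ws) (L-x′ ∷ L-ws)))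

  module Lattice (π : ℤ) (k : ℕ) {s : ℕ} where

    Generator : Set
    Generator = ℕ × Row s

    InLattice : List Generator → Row s → Set
    InLattice []            x = ∀ l → π ^ k ∣ x l
    InLattice ((a , u) ∷ T) x = ∃[ x′ ] (InLattice T x′ × Shift (π ^ a) u x x′)

    deficit : List Generator → ℕ
    deficit []            = 0
    deficit ((a , _) ∷ T) = k ℕ.∸ a ℕ.+ deficit T

    pow-∣ : ∀ {m n} → m ℕ.≤ n → π ^ m ∣ π ^ n
    pow-∣ {m} {n} m≤n = subst (λ h → π ^ m ∣ π ^ h) (ℕₚ.m+[n∸m]≡n m≤n)
      (subst (π ^ m ∣_) (sym (ℤₚ.^-distribˡ-+-* π m _)) (ℤ∣.∣m⇒∣m*n _ ℤ∣.∣-refl))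

    full-divisible : ∀ q {D : Form s q} → Alternating q D → ∀ {vs} → All (InLattice []) vs → π ^ (k ℕ.* q) ∣ D vs
    full-divisible zero {D} alt [] rewrite ℕₚ.*-zeroʳ k = divides (D []) (sym (ℤₚ.*-identityʳ (D [])))
    full-divisible (suc q) {D} (cons lin tail _) {x ∷ vs} (d ∷ ds) =
      subst₂ _∣_ (trans (sym (ℤₚ.^-distribˡ-+-* π k (k ℕ.* q))) (cong (π ^_) (sym (ℕₚ.*-suc k q)))) (sym expansion)
        (ℤ∣.*-monoʳ-∣ (π ^ k) (full-divisible q (tail y) ds))
      where
      y : Row s
      y l = _∣_.quotient (d l)
      o : Row s
      o _ = 0ℤ
      o-zero : D (o ∷ vs) ≡ 0ℤ
      o-zero = double _ (lin 1ℤ o o o vs (λ _ → refl))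
        where
        double : ∀ a → a ≡ a + 1ℤ * a → a ≡ 0ℤ
        double a eq = trans (lhs a) (trans (cong (_+ - a) (sym eq)) (ℤₚ.+-inverseʳ a))
          where
          lhs : ∀ a → a ≡ a + 1ℤ * a + - a
          lhs = solve-∀
      commute : ∀ a b → a * b ≡ 0ℤ + b * a
      commute = solve-∀
      expansion : D (x ∷ vs) ≡ π ^ k * D (y ∷ vs)
      expansion = trans (lin (π ^ k) o y x vs λ l → trans (_∣_.equality (d l)) (commute (y l) (π ^ k)))
                        (trans (cong (_+ π ^ k * D (y ∷ vs)) o-zero) (ℤₚ.+-identityˡ _))

    split : ∀ a u T {q} {vs : Vec (Row s) q} → All (InLattice ((a , u) ∷ T)) vs →
      ∃[ vs′ ] (All (InLattice T) vs′ × Pointwise (Shift (π ^ a) u) {q} {q} vs vs′)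
    split a u T [] = [] , [] , []
    split a u T ((x′ , L , sh) ∷ ds) with vs′ , Ls , shs ← split a u T ds = x′ ∷ vs′ , L ∷ Ls , sh ∷ shs

    -- Induction on the generators. With none left, every row yields a factor π^k. Removing (a , u)
    -- produces the form without `u`, which has more room in the bound, and the minors in which `u`
    -- occupies one row.
    alternating-divisible : ∀ T q {D : Form s q} → Alternating q D → ∀ {vs} → All (InLattice T) vs →
      ∀ N → N ℕ.+ deficit T ℕ.≤ k ℕ.* q → π ^ N ∣ D vs
    alternating-divisible []            q alt ds N bound =
      ℤ∣.∣-trans (pow-∣ (subst (ℕ._≤ k ℕ.* q) (ℕₚ.+-identityʳ N) bound)) (full-divisible q alt ds)
    alternating-divisible ((a , u) ∷ T) q {D} alt ds N bound with vs′ , Ls , shs ← split a u T ds =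
      expand q alt shs Ls
        (alternating-divisible T q alt Ls N (ℕₚ.≤-trans (ℕₚ.+-monoʳ-≤ N (ℕₚ.m≤n+m _ _)) bound))
        (minors q alt bound)
      where
      minors : ∀ q {D : Form s q} → Alternating q D → N ℕ.+ (k ℕ.∸ a ℕ.+ deficit T) ℕ.≤ k ℕ.* q →
               MinorsDivisible (π ^ N) (π ^ a) u (InLattice T) q D
      minors zero    _ _ = tt
      minors (suc q) (cons _ tail _) bound ws L-ws with ℕₚ.≤-total N a
      ... | inj₁ N≤a = ℤ∣.∣m⇒∣m*n _ (pow-∣ N≤a)
      -- The factor π^a is already present, so the minor has to supply only π^(N - a). It has one
      -- row fewer, a loss of `k`, against which the deficit drops by k - a and the required
      -- exponent by a.
      ... | inj₂ a≤N = subst (_∣ _) (trans (sym (ℤₚ.^-distribˡ-+-* π a (N ℕ.∸ a))) (cong (π ^_) (ℕₚ.m+[n∸m]≡n a≤N)))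
          (ℤ∣.*-monoʳ-∣ (π ^ a) (alternating-divisible T q (tail u) L-ws (N ℕ.∸ a)
            (ℕₚ.+-cancelˡ-≤ (k ℕ.+ a) _ _ (begin
              k ℕ.+ a ℕ.+ (N ℕ.∸ a ℕ.+ deficit T)        ≡⟨ regroup k a (N ℕ.∸ a) (deficit T) ⟩
              k ℕ.+ (a ℕ.+ (N ℕ.∸ a) ℕ.+ deficit T)      ≡⟨ cong (λ h → k ℕ.+ (h ℕ.+ deficit T)) (ℕₚ.m+[n∸m]≡n a≤N) ⟩
              k ℕ.+ (N ℕ.+ deficit T)                    ≤⟨ ℕₚ.+-monoˡ-≤ _ (ℕₚ.m≤n+m∸n k a) ⟩
              a ℕ.+ (k ℕ.∸ a) ℕ.+ (N ℕ.+ deficit T)      ≡⟨ regroup₂ a (k ℕ.∸ a) N (deficit T) ⟩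
              a ℕ.+ (N ℕ.+ (k ℕ.∸ a ℕ.+ deficit T))      ≤⟨ ℕₚ.+-monoʳ-≤ a bound ⟩
              a ℕ.+ k ℕ.* suc q                          ≡⟨ regroup₃ a k q ⟩
              k ℕ.+ a ℕ.+ k ℕ.* q                        ∎))))
        where
        open ℕₚ.≤-Reasoning
        regroup : ∀ k a b d → k ℕ.+ a ℕ.+ (b ℕ.+ d) ≡ k ℕ.+ (a ℕ.+ b ℕ.+ d)
        regroup = ℕ-solve-∀
        regroup₂ : ∀ a b n d → a ℕ.+ b ℕ.+ (n ℕ.+ d) ≡ a ℕ.+ (n ℕ.+ (b ℕ.+ d))
        regroup₂ = ℕ-solve-∀
        regroup₃ : ∀ a k q → a ℕ.+ k ℕ.* suc q ≡ k ℕ.+ a ℕ.+ k ℕ.* q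
        regroup₃ = ℕ-solve-∀

-- Counting exponent vectors below a given degree.

module Exponents where

  open import Data.Nat as ℕ using (ℕ; zero; suc; _+_; _*_; _∸_; _≤_; _<_; z≤n; s≤s)
  open import Data.Nat.Properties as ℕₚ
  open import Data.Nat.Tactic.RingSolver using (solve-∀)
  open import Data.List using (_++_; map)
  open import Data.List.Membership.Propositional.Properties using (∈-++⁺ˡ; ∈-++⁺ʳ; ∈-map⁺)
  open import Data.List.Relation.Unary.Any using (here)
  open import Data.Vec using (Vec; []; _∷_; zipWith; sum)

  partialSum : (ℕ → ℕ) → ℕ → ℕ
  partialSum g zero    = 0
  partialSum g (suc t) = g (suc t) + partialSum g t

  -- h n t is the binomial coefficient C(t + n - 1, n).
  h : ℕ → ℕ → ℕ
  h zero    t = 1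
  h (suc n) t = partialSum (h n) t

  partialSum-mono : ∀ g {t u} → t ≤ u → partialSum g t ≤ partialSum g u
  partialSum-mono g z≤n = z≤n
  partialSum-mono g {suc t} {suc u} (s≤s t≤u) with ℕₚ.m≤n⇒m<n∨m≡n t≤u
  ... | inj₁ t<u  = ≤-trans (partialSum-mono g t<u) (m≤n+m _ (g (suc u)))
  ... | inj₂ refl = ≤-refl

  partialSum-monoˡ : ∀ {f g : ℕ → ℕ} → (∀ v → f v ≤ g v) → ∀ t → partialSum f t ≤ partialSum g t
  partialSum-monoˡ f≤g zero    = z≤n
  partialSum-monoˡ f≤g (suc t) = +-mono-≤ (f≤g (suc t)) (partialSum-monoˡ f≤g t)

  partialSum-* : ∀ c g t → partialSum (λ u → c * g u) t ≡ c * partialSum g t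
  partialSum-* c g zero    = sym (*-zeroʳ c)
  partialSum-* c g (suc t) = trans (cong (c * g (suc t) +_) (partialSum-* c g t)) (sym (*-distribˡ-+ c (g (suc t)) _))

  h-mono : ∀ n {t u} → t ≤ u → h n t ≤ h n u
  h-mono zero    _   = ≤-refl
  h-mono (suc n) t≤u = partialSum-mono (h n) t≤u

  -- The absorption identity, and the ratio of neighbouring binomial coefficients in `h-shift`.
  -- Pascal's rule for either one calls for both, hence the mutual induction.
  h-absorb  : ∀ n t → suc n * h (suc n) t ≡ (t + n) * h n t
  h-shift : ∀ n t → t * h n (suc t) ≡ (t + n) * h n t
  h-absorb n zero    = base n
    where
    base : ∀ n → suc n * 0 ≡ n * h n 0
    base zero    = refl
    base (suc n) = trans (*-zeroʳ (2 + n)) (sym (*-zeroʳ (suc n)))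
  h-absorb n (suc t) = begin
    suc n * (h n (suc t) + h (suc n) t)         ≡⟨ *-distribˡ-+ (suc n) (h n (suc t)) _ ⟩
    suc n * h n (suc t) + suc n * h (suc n) t   ≡⟨ cong (suc n * h n (suc t) +_) (h-absorb n t) ⟩
    suc n * h n (suc t) + (t + n) * h n t       ≡⟨ cong (suc n * h n (suc t) +_) (h-shift n t) ⟨
    suc n * h n (suc t) + t * h n (suc t)       ≡⟨ regroup n t (h n (suc t)) ⟩
    suc (t + n) * h n (suc t)                   ∎
    where
    open ≡-Reasoning
    regroup : ∀ n t x → suc n * x + t * x ≡ suc (t + n) * x
    regroup = solve-∀
  h-shift zero    t = cong (_* 1) (sym (+-identityʳ t))
  h-shift (suc n) t = begin
    t * (h n (suc t) + h (suc n) t)         ≡⟨ *-distribˡ-+ t (h n (suc t)) _ ⟩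
    t * h n (suc t) + t * h (suc n) t       ≡⟨ cong (_+ t * h (suc n) t) (trans (h-shift n t) (sym (h-absorb n t))) ⟩
    suc n * h (suc n) t + t * h (suc n) t   ≡⟨ regroup n t (h (suc n) t) ⟩
    (t + suc n) * h (suc n) t               ∎
    where
    open ≡-Reasoning
    regroup : ∀ n t x → suc n * x + t * x ≡ (t + suc n) * x
    regroup = solve-∀

  Exponent : ℕ → Set
  Exponent = Vec ℕ

  slices : ∀ {n} → (ℕ → List (Exponent n)) → ℕ → ℕ → ℕ → List (Exponent (suc n))
  slices L b zero    u       = []
  slices L b (suc c) zero    = []
  slices L b (suc c) (suc u) = map (b ∷_) (L (suc u)) ++ slices L (suc b) c u

  exponentsBelow : ∀ n → ℕ → List (Exponent n)
  exponentsBelow zero    t = [] ∷ []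
  exponentsBelow (suc n) t = slices (exponentsBelow n) 0 t t

  -- The two families, first coordinate below `a` and tail not a multiple of `α`, overlap. A
  -- repeated exponent is counted twice by `gap`, and the upper bound below allows for that.
  nonMultiples : ∀ {n} → Exponent n → ℕ → List (Exponent n)
  nonMultiples []      t = []
  nonMultiples (a ∷ α) t = slices (exponentsBelow _) 0 a t ++ slices (nonMultiples α) 0 t t

  gap : ∀ {n} → ℕ → List (Exponent n) → ℕ
  gap t []      = 0
  gap t (β ∷ L) = (t ∸ sum β) + gap t L

  gap-++ : ∀ {n} t (K L : List (Exponent n)) → gap t (K ++ L) ≡ gap t K + gap t L
  gap-++ t []      L = refl
  gap-++ t (β ∷ K) L = trans (cong ((t ∸ sum β) +_) (gap-++ t K L)) (sym (+-assoc (t ∸ sum β) _ _))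

  gap-map : ∀ {n} b u (L : List (Exponent n)) → gap (b + u) (map (b ∷_) L) ≡ gap u L
  gap-map b u []      = refl
  gap-map b u (β ∷ L) = cong₂ _+_ (trans (sym (∸-+-assoc (b + u) b (sum β))) (cong (_∸ sum β) (m+n∸m≡n b u))) (gap-map b u L)

  gap-slices-suc : ∀ {n} (L : ℕ → List (Exponent n)) b c u →
    gap (b + suc u) (slices L b (suc c) (suc u)) ≡ gap (suc u) (L (suc u)) + gap (suc b + u) (slices L (suc b) c u)
  gap-slices-suc L b c u = trans (gap-++ (b + suc u) (map (b ∷_) (L (suc u))) _)
    (cong₂ _+_ (gap-map b (suc u) (L (suc u))) (cong (λ t → gap t (slices L (suc b) c u)) (+-suc b u)))

  gap-slices-sum : ∀ {n} (L : ℕ → List (Exponent n)) (g : ℕ → ℕ) → (∀ v → gap v (L v) ≤ g v) →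
    ∀ b c u → gap (b + u) (slices L b c u) ≤ partialSum g u
  gap-slices-sum L g L≤g b zero    u       = z≤n
  gap-slices-sum L g L≤g b (suc c) zero    = z≤n
  gap-slices-sum L g L≤g b (suc c) (suc u) = begin
    gap (b + suc u) (slices L b (suc c) (suc u))                      ≡⟨ gap-slices-suc L b c u ⟩
    gap (suc u) (L (suc u)) + gap (suc b + u) (slices L (suc b) c u)  ≤⟨ +-mono-≤ (L≤g (suc u)) (gap-slices-sum L g L≤g (suc b) c u) ⟩
    g (suc u) + partialSum g u                                        ∎
    where open ≤-Reasoning

  -- With only `c` slices each one is estimated by the first, which has the most degree left. This
  -- gives a factor `c` where the sum over all slices would raise the order of `h`.
  gap-slices-* : ∀ {n} (L : ℕ → List (Exponent n)) (g : ℕ → ℕ) → (∀ v → gap v (L v) ≤ g v) → (∀ {t u} → t ≤ u → g t ≤ g u) →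
    ∀ b c u → gap (b + u) (slices L b c u) ≤ c * g u
  gap-slices-* L g L≤g g-mono b zero    u       = z≤n
  gap-slices-* L g L≤g g-mono b (suc c) zero    = z≤n
  gap-slices-* L g L≤g g-mono b (suc c) (suc u) = begin
    gap (b + suc u) (slices L b (suc c) (suc u))                      ≡⟨ gap-slices-suc L b c u ⟩
    gap (suc u) (L (suc u)) + gap (suc b + u) (slices L (suc b) c u)  ≤⟨ +-mono-≤ (L≤g (suc u)) (gap-slices-* L g L≤g g-mono (suc b) c u) ⟩
    g (suc u) + c * g u                                               ≤⟨ +-monoʳ-≤ (g (suc u)) (*-monoʳ-≤ c (g-mono (n≤1+n u))) ⟩
    g (suc u) + c * g (suc u)                                         ∎
    where open ≤-Reasoning

  -- The number t - |β| counts the values of one additional coordinate that keep the degree below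
  -- `t`, so the sum counts exponents in n + 1 variables.
  gap-exponentsBelow : ∀ n t → gap t (exponentsBelow n t) ≤ h (suc n) t
  gap-exponentsBelow zero    t = ≤-reflexive (trans (+-identityʳ t) (sym (h₁ t)))
    where
    h₁ : ∀ t → h 1 t ≡ t
    h₁ zero    = refl
    h₁ (suc t) = cong suc (h₁ t)
  gap-exponentsBelow (suc n) t = gap-slices-sum (exponentsBelow n) (h (suc n)) (gap-exponentsBelow n) 0 t t

  -- A β outside α + ℕⁿ has β_i < α_i for some i; with the value of β_i fixed the other coordinates are free.
  gap-nonMultiples : ∀ {n} (α : Exponent n) t → gap t (nonMultiples α t) ≤ sum α * h n t
  gap-nonMultiples []                t = z≤n
  gap-nonMultiples {suc n} (a ∷ α) t = begin
    gap t (slices (exponentsBelow n) 0 a t ++ slices (nonMultiples α) 0 t t)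
      ≡⟨ gap-++ t (slices (exponentsBelow n) 0 a t) _ ⟩
    gap t (slices (exponentsBelow n) 0 a t) + gap t (slices (nonMultiples α) 0 t t)
      ≤⟨ +-mono-≤ (gap-slices-* (exponentsBelow n) (h (suc n)) (gap-exponentsBelow n) (h-mono (suc n)) 0 a t)
                  (gap-slices-sum (nonMultiples α) (λ u → sum α * h n u) (gap-nonMultiples α) 0 t t) ⟩
    a * h (suc n) t + partialSum (λ u → sum α * h n u) t
      ≡⟨ cong (a * h (suc n) t +_) (partialSum-* (sum α) (h n) t) ⟩
    a * h (suc n) t + sum α * h (suc n) t
      ≡⟨ *-distribʳ-+ (h (suc n) t) a (sum α) ⟨
    (a + sum α) * h (suc n) t ∎
    where open ≤-Reasoning

  ∈-slices : ∀ {n} (L : ℕ → List (Exponent n)) {β} b {c u} i → i < c → i < u → β ∈ L (u ∸ i) →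
    (b + i) ∷ β ∈ slices L b c u
  ∈-slices L b {suc c} {suc u} zero    _         _         β∈L rewrite +-identityʳ b = ∈-++⁺ˡ (∈-map⁺ (b ∷_) β∈L)
  ∈-slices L b {suc c} {suc u} (suc i) (s≤s i<c) (s≤s i<u) β∈L rewrite +-suc b i =
    ∈-++⁺ʳ (map (b ∷_) (L (suc u))) (∈-slices L (suc b) i i<c i<u β∈L)

  head-below : ∀ {b m t} → b + m < t → b < t
  head-below {b} {m} = ≤-<-trans (m≤m+n b m)

  tail-below : ∀ {b m t} → b + m < t → m < t ∸ b
  tail-below {b} {m} {t} lt = subst (_≤ t ∸ b) (m+n∸m≡n b (suc m)) (∸-monoˡ-≤ b (subst (_≤ t) (sym (+-suc b m)) lt))

  ∈-exponentsBelow : ∀ {n} (β : Exponent n) {t} → sum β < t → β ∈ exponentsBelow n t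
  ∈-exponentsBelow []      _  = here refl
  ∈-exponentsBelow (b ∷ β) lt =
    ∈-slices (exponentsBelow _) 0 b (head-below lt) (head-below lt) (∈-exponentsBelow β (tail-below lt))

  _⊕_ : ∀ {n} → Exponent n → Exponent n → Exponent n
  _⊕_ = zipWith _+_

  multiple⊎∈nonMultiples : ∀ {n} (α β : Exponent n) {t} → sum β < t →
    (∃[ γ ] β ≡ γ ⊕ α) ⊎ β ∈ nonMultiples α t
  multiple⊎∈nonMultiples []      []      _  = inj₁ ([] , refl)
  multiple⊎∈nonMultiples (a ∷ α) (b ∷ β) {t} lt with b <? a
  ... | yes b<a = inj₂ (∈-++⁺ˡ (∈-slices (exponentsBelow _) 0 b b<a (head-below lt) (∈-exponentsBelow β (tail-below lt))))
  ... | no  b≮a with multiple⊎∈nonMultiples α β (tail-below lt)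
  ...   | inj₁ (γ , refl) = inj₁ (b ∸ a ∷ γ , cong (_∷ γ ⊕ α) (sym (m∸n+n≡m (≮⇒≥ b≮a))))
  ...   | inj₂ β∈ = inj₂ (∈-++⁺ʳ (slices (exponentsBelow _) 0 a t) (∈-slices (nonMultiples α) 0 b (head-below lt) (head-below lt) β∈))

-- Reduction of monomials by the equation, modulo a power of π.

module LatticeReduction where

  open AlternatingForms
  open Exponents using (Exponent; _⊕_; nonMultiples; multiple⊎∈nonMultiples; gap)
  open import Data.Nat as ℕ using (ℕ; zero; suc; _≤_; _<_)
  import Data.Nat.Properties as ℕₚ
  open import Data.Integer as ℤ using (ℤ; +_; -_; _+_; _*_; _^_; 0ℤ; 1ℤ)
  import Data.Integer.Properties as ℤₚ
  open import Data.Integer.Divisibility.Signed as ℤ∣ using (_∣_; divides)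
  open import Data.Integer.Tactic.RingSolver using (solve-∀)
  open import Data.List using (map)
  open import Data.List.Membership.Propositional.Properties using (∈-map⁺)
  open import Data.List.Relation.Unary.Any using (here; there)
  import Data.List.Relation.Unary.All as ListAll
  open import Data.List.Relation.Unary.AllPairs using ([]; _∷_)
  open import Data.List.Relation.Unary.Unique.Propositional using (Unique)
  open import Data.Vec using ([]; _∷_; lookup; sum)
  open import Data.Vec.Properties using (≡-dec)
  open import Data.Empty using (⊥-elim)

  monomial : ∀ {n} → Exponent n → (Fin n → ℤ) → ℤ
  monomial β = monoEval (lookup β)

  monomial-⊕ : ∀ {n} (α β : Exponent n) z → monomial (α ⊕ β) z ≡ monomial α z * monomial β z
  monomial-⊕ []      []      z = refl
  monomial-⊕ (a ∷ α) (b ∷ β) z =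
    trans (cong₂ _*_ (ℤₚ.^-distribˡ-+-* (z zero) a b) (monomial-⊕ α β (z ∘ suc))) (interchange (z zero ^ a) (z zero ^ b) _ _)
    where
    interchange : ∀ a b c d → a * b * (c * d) ≡ a * c * (b * d)
    interchange = solve-∀

  ^-*-distrib : ∀ x y n → (x * y) ^ n ≡ x ^ n * y ^ n
  ^-*-distrib x y zero    = refl
  ^-*-distrib x y (suc n) = trans (cong (x * y *_) (^-*-distrib x y n)) (interchange x y (x ^ n) (y ^ n))
    where
    interchange : ∀ a b c d → a * b * (c * d) ≡ a * c * (b * d)
    interchange = solve-∀

  monomial-scale : ∀ {n} t (β : Exponent n) y → monomial β (λ i → t * y i) ≡ t ^ sum β * monomial β y
  monomial-scale t []      y = refl
  monomial-scale t (b ∷ β) y = trans (cong₂ _*_ (^-*-distrib t (y zero) b) (monomial-scale t β (y ∘ suc)))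
    (trans (interchange (t ^ b) (y zero ^ b) _ _) (cong (_* (y zero ^ b * monomial β (y ∘ suc))) (sym (ℤₚ.^-distribˡ-+-* t b (sum β)))))
    where
    interchange : ∀ a b c d → a * b * (c * d) ≡ a * c * (b * d)
    interchange = solve-∀

  sumOver : ∀ {A : Set} → List A → (A → ℤ) → ℤ
  sumOver []       F = 0ℤ
  sumOver (α ∷ xs) F = F α + sumOver xs F

  sumOver-cong : ∀ {A : Set} (xs : List A) {F G : A → ℤ} → (∀ α → α ∈ xs → F α ≡ G α) → sumOver xs F ≡ sumOver xs G
  sumOver-cong []       eq = refl
  sumOver-cong (α ∷ xs) eq = cong₂ _+_ (eq α (here refl)) (sumOver-cong xs λ β β∈ → eq β (there β∈))

  sumOver-* : ∀ {A : Set} (xs : List A) c (F : A → ℤ) → sumOver xs (λ α → c * F α) ≡ c * sumOver xs F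
  sumOver-* []       c F = sym (ℤₚ.*-zeroʳ c)
  sumOver-* (α ∷ xs) c F = trans (cong (λ h → c * F α + h) (sumOver-* xs c F)) (sym (ℤₚ.*-distribˡ-+ c (F α) _))

  module _ {A : Set} (_≟_ : (x y : A) → Dec (x ≡ y)) where

    -- The term at `α₀` is set to zero and the list of indices is kept, so that the sums before and
    -- after the removal run over the same list.
    without : A → (A → ℤ) → A → ℤ
    without α₀ F α with α ≟ α₀
    ... | yes _ = 0ℤ
    ... | no  _ = F α

    without-≢ : ∀ {α₀ α} F → α ≢ α₀ → without α₀ F α ≡ F α
    without-≢ {α₀} {α} F α≢ with α ≟ α₀
    ... | yes eq = ⊥-elim (α≢ eq)
    ... | no  _  = refl

    without-≡ : ∀ α₀ F → without α₀ F α₀ ≡ 0ℤ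
    without-≡ α₀ F with α₀ ≟ α₀
    ... | yes _  = refl
    ... | no  ne = ⊥-elim (ne refl)

    sumOver-isolate : ∀ {xs α₀} F → Unique xs → α₀ ∈ xs → sumOver xs F ≡ F α₀ + sumOver xs (without α₀ F)
    sumOver-isolate {α ∷ xs} F (fresh ∷ _) (here refl) = cong (λ h → F α + h)
      (trans (sumOver-cong xs λ β β∈ → sym (without-≢ F λ eq → ListAll.lookup fresh β∈ (sym eq)))
        (trans (sym (ℤₚ.+-identityˡ _)) (cong (_+ sumOver xs (without α F)) (sym (without-≡ α F)))))
    sumOver-isolate {α ∷ xs} {α₀} F (fresh ∷ u) (there α₀∈) =
      trans (cong₂ _+_ (sym (without-≢ F (ListAll.lookup fresh α₀∈))) (sumOver-isolate F u α₀∈))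
        (swap-front (without α₀ F α) (F α₀) _)
      where
      swap-front : ∀ a b c → a + (b + c) ≡ b + (a + c)
      swap-front = solve-∀

  module LatticeClosure (π : ℤ) (k : ℕ) {s : ℕ} where
    open Lattice π k {s} public

    cong-∈ : ∀ T {x y} → (∀ l → x l ≡ y l) → InLattice T y → InLattice T x
    cong-∈ []      eq d = λ l → subst (π ^ k ∣_) (sym (eq l)) (d l)
    cong-∈ (_ ∷ T) eq (x′ , L , c , sh) = x′ , L , c , λ l → trans (eq l) (sh l)

    divisible-∈ : ∀ T {x} → (∀ l → π ^ k ∣ x l) → InLattice T x
    divisible-∈ []            d = d
    divisible-∈ ((a , u) ∷ T) {x} d = x , divisible-∈ T d , 0ℤ , λ l → trivial (x l) (π ^ a) (u l)
      where
      trivial : ∀ x a u → x ≡ x + 0ℤ * a * u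
      trivial = solve-∀

    linear-∈ : ∀ T c {x y} → InLattice T x → InLattice T y → InLattice T (λ l → x l + c * y l)
    linear-∈ []            c dx dy = λ l → ℤ∣.∣m∣n⇒∣m+n (dx l) (ℤ∣.∣n⇒∣m*n c (dy l))
    linear-∈ ((a , u) ∷ T) c (x′ , Lx , cx , shx) (y′ , Ly , cy , shy) =
      (λ l → x′ l + c * y′ l) , linear-∈ T c Lx Ly , cx + c * cy ,
      λ l → trans (cong₂ (λ x y → x + c * y) (shx l) (shy l)) (collect (x′ l) cx (π ^ a) (u l) c (y′ l) cy)
      where
      collect : ∀ x d a u c y e → x + d * a * u + c * (y + e * a * u) ≡ x + c * y + (d + c * e) * a * u
      collect = solve-∀

    zero-∈ : ∀ T → InLattice T (λ _ → 0ℤ)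
    zero-∈ T = divisible-∈ T λ _ → divides 0ℤ (sym (ℤₚ.*-zeroˡ (π ^ k)))

    generator-∈ : ∀ {T a u} c → (a , u) ∈ T → InLattice T (λ l → c * π ^ a * u l)
    generator-∈ {_ ∷ T} {a} {u} c (here refl) = (λ _ → 0ℤ) , zero-∈ T , c , λ l → sym (ℤₚ.+-identityˡ _)
    generator-∈ {(b , v) ∷ T} {a} {u} c (there g∈) =
      (λ l → c * π ^ a * u l) , generator-∈ c g∈ , 0ℤ , λ l → trivial (c * π ^ a * u l) (π ^ b) (v l)
      where
      trivial : ∀ x a u → x ≡ x + 0ℤ * a * u
      trivial = solve-∀

    sumOver-∈ : ∀ {A : Set} T (xs : List A) {F : A → Row s} → (∀ α → α ∈ xs → InLattice T (F α)) →
      InLattice T (λ l → sumOver xs (λ α → F α l))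
    sumOver-∈ T []       mem = zero-∈ T
    sumOver-∈ T (α ∷ xs) {F} mem = cong-∈ T (λ l → cong (λ h → F α l + h) (sym (ℤₚ.*-identityˡ _)))
      (linear-∈ T 1ℤ (mem α (here refl)) (sumOver-∈ T xs λ β β∈ → mem β (there β∈)))

  -- A division algorithm by the relation, with leading monomial z^α₀, at the points z = π y; the weight ν
  -- accounts for the rescaling of homogeneous coordinates.
  module Reduction (π : ℤ) (k : ℕ) {s n : ℕ} (y : Fin s → Fin n → ℤ) (ν : Fin s → ℤ)
    (box : List (Exponent n)) (unique : Unique box) (c : Exponent n → ℤ)
    (relation : ∀ l → π ^ k ∣ sumOver box (λ α → c α * monomial α (λ i → π * y l i)))
    (α₀ : Exponent n) (α₀∈ : α₀ ∈ box) (v : ℤ) (inverse : π ^ k ∣ 1ℤ + - (v * c α₀))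
    (Ω : Exponent n → ℕ) (W : ℕ) .{{_ : ℕ.NonZero W}}
    (Ω-⊕ : ∀ α β → Ω (α ⊕ β) ≡ Ω α ℕ.+ Ω β) (Ω-bound : ∀ α → Ω α ≤ W ℕ.* sum α)
    (leading : ∀ α → α ∈ box → α ≢ α₀ → π ∣ c α ⊎ Ω α₀ < Ω α)
    where

    open LatticeClosure π k {s}

    z : Fin s → Fin n → ℤ
    z l i = π * y l i

    row : Exponent n → Row s
    row β l = ν l * monomial β (z l)

    generator : Exponent n → Generator
    generator β = sum β , λ l → ν l * monomial β (y l)

    T : List Generator
    T = map generator (nonMultiples α₀ k)

    row-scale : ∀ e β l → π ^ e * row β l ≡ π ^ e * π ^ sum β * (ν l * monomial β (y l))
    row-scale e β l = trans (cong (λ h → π ^ e * (ν l * h)) (monomial-scale π β (y l)))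
      (regroup (π ^ e) (ν l) (π ^ sum β) (monomial β (y l)))
      where
      regroup : ∀ a b c d → a * (b * (c * d)) ≡ a * c * (b * d)
      regroup = solve-∀

    high-degree : ∀ e β → k ≤ sum β → ∀ l → π ^ k ∣ π ^ e * row β l
    high-degree e β k≤ l = subst (π ^ k ∣_) (sym (row-scale e β l))
      (ℤ∣.∣m⇒∣m*n _ (ℤ∣.∣n⇒∣m*n (π ^ e) (pow-∣ k≤)))

    _≟ᵛ_ : (α β : Exponent n) → Dec (α ≡ β)
    _≟ᵛ_ = ≡-dec ℕ._≟_

    term : Fin s → Exponent n → ℤ
    term l α = c α * monomial α (z l)

    -- π^e ν z^(γ+α₀) modulo π^k, with z^α₀ eliminated by means of the relation.
    eliminate : ∀ e γ l → π ^ e * row (γ ⊕ α₀) l ≡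
      (π ^ e * row (γ ⊕ α₀) l * (1ℤ + - (v * c α₀)) + v * (π ^ e * row γ l) * sumOver box (term l))
      + - v * sumOver box (λ α → π ^ e * row γ l * without _≟ᵛ_ α₀ (term l) α)
    eliminate e γ l = sym (begin
      (R * (1ℤ + - (v * c α₀)) + v * Q * sumOver box (term l)) + - v * sumOver box (λ α → Q * rest α)
        ≡⟨ cong₂ (λ g r → (R * (1ℤ + - (v * c α₀)) + v * Q * g) + - v * r)
             (sumOver-isolate _≟ᵛ_ (term l) unique α₀∈) (sumOver-* box Q rest) ⟩
      (R * (1ℤ + - (v * c α₀)) + v * Q * (c α₀ * Z + S)) + - v * (Q * S)
        ≡⟨ cong (λ r → (r * (1ℤ + - (v * c α₀)) + v * Q * (c α₀ * Z + S)) + - v * (Q * S)) R≡QZ ⟩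
      (Q * Z * (1ℤ + - (v * c α₀)) + v * Q * (c α₀ * Z + S)) + - v * (Q * S)
        ≡⟨ collapse Q Z v (c α₀) S ⟩
      Q * Z
        ≡⟨ R≡QZ ⟨
      R ∎)
      where
      open ≡-Reasoning
      R = π ^ e * row (γ ⊕ α₀) l
      Q = π ^ e * row γ l
      Z = monomial α₀ (z l)
      rest = without _≟ᵛ_ α₀ (term l)
      S = sumOver box rest
      collapse : ∀ q z v c s → (q * z * (1ℤ + - (v * c)) + v * q * (c * z + s)) + - v * (q * s) ≡ q * z
      collapse = solve-∀
      regroup : ∀ a b c d → a * (b * (c * d)) ≡ a * (b * c) * d
      regroup = solve-∀
      R≡QZ : R ≡ Q * Z
      R≡QZ = trans (cong (λ h → π ^ e * (ν l * h)) (monomial-⊕ γ α₀ (z l)))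
                   (regroup (π ^ e) (ν l) (monomial γ (z l)) (monomial α₀ (z l)))

    -- The first two summands of `eliminate` are divisible by π^k, by the choice of `v` and by the
    -- relation. In the last one each monomial has either a coefficient divisible by π, which raises
    -- `e`, or a larger weight `Ω`; the two hypotheses answer these cases.
    reduce-multiple : ∀ e γ → (∀ β → InLattice T (λ l → π ^ suc e * row β l)) →
      (∀ β → Ω (γ ⊕ α₀) < Ω β → InLattice T (λ l → π ^ e * row β l)) →
      InLattice T (λ l → π ^ e * row (γ ⊕ α₀) l)
    reduce-multiple e γ IH-π IH-Ω = cong-∈ T (eliminate e γ)
      (linear-∈ T (- v)
        (divisible-∈ T λ l → ℤ∣.∣m∣n⇒∣m+n (ℤ∣.∣n⇒∣m*n (π ^ e * row (γ ⊕ α₀) l) inverse)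
                                         (ℤ∣.∣n⇒∣m*n (v * (π ^ e * row γ l)) (relation l)))
        (sumOver-∈ T box term-∈))
      where
      regroup : ∀ e b g c a → e * (b * g) * (c * a) ≡ 0ℤ + c * (e * (b * (g * a)))
      regroup = solve-∀
      regroup-π : ∀ e b g q p a → e * (b * g) * (q * p * a) ≡ 0ℤ + q * (p * e * (b * (g * a)))
      regroup-π = solve-∀
      term-∈ : ∀ α → α ∈ box → InLattice T (λ l → π ^ e * row γ l * without _≟ᵛ_ α₀ (term l) α)
      term-∈ α α∈ with α ≟ᵛ α₀
      ... | yes _ = cong-∈ T (λ l → ℤₚ.*-zeroʳ (π ^ e * row γ l)) (zero-∈ T)
      ... | no α≢ with leading α α∈ α≢
      ...   | inj₁ (divides q cα≡) = cong-∈ T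
          (λ l → trans (cong (λ h → π ^ e * row γ l * (h * monomial α (z l))) cα≡)
            (trans (regroup-π (π ^ e) (ν l) (monomial γ (z l)) q π (monomial α (z l)))
              (cong (λ h → 0ℤ + q * (π ^ suc e * (ν l * h))) (sym (monomial-⊕ γ α (z l))))))
          (linear-∈ T q (zero-∈ T) (IH-π (γ ⊕ α)))
      ...   | inj₂ Ω< = cong-∈ T
          (λ l → trans (regroup (π ^ e) (ν l) (monomial γ (z l)) (c α) (monomial α (z l)))
              (cong (λ h → 0ℤ + c α * (π ^ e * (ν l * h))) (sym (monomial-⊕ γ α (z l)))))
          (linear-∈ T (c α) (zero-∈ T) (IH-Ω (γ ⊕ α)
            (subst₂ _<_ (sym (Ω-⊕ γ α₀)) (sym (Ω-⊕ γ α)) (ℕₚ.+-monoʳ-< (Ω γ) Ω<))))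

    reduce : ∀ e β → (∀ β′ → InLattice T (λ l → π ^ suc e * row β′ l)) →
      (∀ β′ → Ω β < Ω β′ → InLattice T (λ l → π ^ e * row β′ l)) →
      InLattice T (λ l → π ^ e * row β l)
    reduce e β IH-π IH-Ω with ℕₚ.≤-<-connex k (sum β)
    ... | inj₁ k≤sum = divisible-∈ T (high-degree e β k≤sum)
    ... | inj₂ sum<k with multiple⊎∈nonMultiples α₀ β sum<k
    ...   | inj₂ β∈         = cong-∈ T (row-scale e β) (generator-∈ (π ^ e) (∈-map⁺ generator β∈))
    ...   | inj₁ (γ , refl) = reduce-multiple e γ IH-π IH-Ω

    -- Lexicographic induction. `i` bounds the factors π still missing from π^k and `j` the weight
    -- still missing from `W * k`. Gaining a factor π may lower the weight, so `j` is then reset to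
    -- its maximum.
    power-row-∈ : ∀ i j e β → k ≤ e ℕ.+ i → W ℕ.* k ≤ Ω β ℕ.+ j → InLattice T (λ l → π ^ e * row β l)
    power-row-∈ zero    j    e β k≤ Wk≤ = divisible-∈ T λ l → ℤ∣.∣m⇒∣m*n _ (pow-∣ (subst (k ≤_) (ℕₚ.+-identityʳ e) k≤))
    -- Once the weight is at least `W * k`, `Ω-bound` forces degree at least `k`, and the row
    -- vanishes modulo π^k because z = π y.
    power-row-∈ (suc i) zero e β k≤ Wk≤ = divisible-∈ T (high-degree e β (ℕₚ.*-cancelˡ-≤ W
      (ℕₚ.≤-trans Wk≤ (ℕₚ.≤-trans (ℕₚ.≤-reflexive (ℕₚ.+-identityʳ (Ω β))) (Ω-bound β)))))
    power-row-∈ (suc i) (suc j) e β k≤ Wk≤ = reduce e β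
      (λ β′ → power-row-∈ i (W ℕ.* k) (suc e) β′ (subst (k ≤_) (ℕₚ.+-suc e i) k≤) (ℕₚ.m≤n+m _ (Ω β′)))
      (λ β′ Ω< → power-row-∈ (suc i) j e β′ k≤ (ℕₚ.≤-trans Wk≤
        (ℕₚ.≤-trans (ℕₚ.≤-reflexive (ℕₚ.+-suc (Ω β) j)) (ℕₚ.+-monoˡ-≤ j Ω<))))

    row-∈ : ∀ β → InLattice T (row β)
    row-∈ β = cong-∈ T (λ l → sym (ℤₚ.*-identityˡ (row β l)))
      (power-row-∈ k (W ℕ.* k) 0 β ℕₚ.≤-refl (ℕₚ.m≤n+m _ (Ω β)))

    deficit-map : ∀ L → deficit (map generator L) ≡ gap k L
    deficit-map []      = refl
    deficit-map (β ∷ L) = cong (k ℕ.∸ sum β ℕ.+_) (deficit-map L)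

-- A degree-compatible weight on a finite box of exponents.

module MonomialOrder where

  open Exponents using (Exponent; _⊕_)
  open import Data.Nat hiding (_%_)
  open import Data.Nat.Properties
  open import Data.Nat.DivMod using (_%_; m<n⇒m%n≡m; [m+kn]%n≡m%n)
  open import Data.Nat.Tactic.RingSolver using (solve-∀)
  open import Data.List using (upTo; cartesianProductWith; filter)
  open import Data.List.Extrema ≤-totalOrder using (argmin; argmin-sel; f[argmin]≤f[⊤]; f[argmin]≤f[xs])
  open import Data.List.Membership.Propositional.Properties
    using (∈-cartesianProductWith⁺; ∈-cartesianProductWith⁻; ∈-upTo⁺; ∈-upTo⁻; ∈-filter⁺; ∈-filter⁻)
  open import Data.List.Relation.Unary.Any using (here)
  import Data.List.Relation.Unary.All as ListAll
  open import Data.List.Relation.Unary.AllPairs using ([]; _∷_)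
  open import Data.List.Relation.Unary.Unique.Propositional using (Unique)
  open import Data.List.Relation.Unary.Unique.Propositional.Properties using (cartesianProductWith⁺; upTo⁺)
  open import Data.Vec using ([]; _∷_; sum)
  open import Data.Vec.Properties using (∷-injective)
  open import Data.Vec.Relation.Unary.All using (All; []; _∷_)
  open import Relation.Unary using (Decidable)

  box : ∀ n → ℕ → List (Exponent n)
  box zero    E = [] ∷ []
  box (suc n) E = cartesianProductWith _∷_ (upTo E) (box n E)

  box-unique : ∀ n E → Unique (box n E)
  box-unique zero    E = ListAll.[] ∷ []
  box-unique (suc n) E = cartesianProductWith⁺ _∷_ ∷-injective (upTo⁺ E) (box-unique n E)

  ∈-box⁺ : ∀ {n E} {α : Exponent n} → All (_< E) α → α ∈ box n E
  ∈-box⁺ []         = here refl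
  ∈-box⁺ (a<E ∷ α<) = ∈-cartesianProductWith⁺ _∷_ (∈-upTo⁺ a<E) (∈-box⁺ α<)

  ∈-box⁻ : ∀ {n E} {α : Exponent n} → α ∈ box n E → All (_< E) α
  ∈-box⁻ {zero}  {α = []} _  = []
  ∈-box⁻ {suc n} {E} α∈ with _ , _ , a∈ , β∈ , refl ← ∈-cartesianProductWith⁻ _∷_ (upTo E) (box n E) α∈ =
    ∈-upTo⁻ a∈ ∷ ∈-box⁻ β∈

  digits-unique : ∀ {E a b} x y → a < E → b < E → a + x * E ≡ b + y * E → a ≡ b × x ≡ y
  digits-unique {E} {a} {b} x y a<E b<E eq = a≡b ,
    *-cancelʳ-≡ x y E (+-cancelˡ-≡ a _ _ (trans eq (cong (_+ y * E) (sym a≡b))))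
    where
    instance
      _ : NonZero E
      _ = >-nonZero (≤-<-trans z≤n a<E)
    a≡b : a ≡ b
    a≡b = begin
      a                ≡⟨ m<n⇒m%n≡m a<E ⟨
      a % E            ≡⟨ [m+kn]%n≡m%n a x E ⟨
      (a + x * E) % E  ≡⟨ cong (_% E) eq ⟩
      (b + y * E) % E  ≡⟨ [m+kn]%n≡m%n b y E ⟩
      b % E            ≡⟨ m<n⇒m%n≡m b<E ⟩
      b                ∎
      where open ≡-Reasoning

  digits : ∀ {n} → ℕ → Exponent n → ℕ
  digits E []      = 0
  digits E (a ∷ α) = a + digits E α * E

  -- Compares exponents by total degree first; on the box it is injective because it is a base E expansion.
  weight : ∀ {n} → ℕ → Exponent n → ℕ
  weight {n} E α = digits E α + sum α * E ^ n

  digits-⊕ : ∀ {n} E (α β : Exponent n) → digits E (α ⊕ β) ≡ digits E α + digits E β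
  digits-⊕ E []      []      = refl
  digits-⊕ E (a ∷ α) (b ∷ β) = trans (cong (λ d → a + b + d * E) (digits-⊕ E α β)) (regroup a b (digits E α) (digits E β) E)
    where
    regroup : ∀ a b x y E → a + b + (x + y) * E ≡ a + x * E + (b + y * E)
    regroup = solve-∀

  sum-⊕ : ∀ {n} (α β : Exponent n) → sum (α ⊕ β) ≡ sum α + sum β
  sum-⊕ []      []      = refl
  sum-⊕ (a ∷ α) (b ∷ β) = trans (cong (a + b +_) (sum-⊕ α β)) (regroup a b (sum α) (sum β))
    where
    regroup : ∀ a b x y → a + b + (x + y) ≡ a + x + (b + y)
    regroup = solve-∀

  weight-⊕ : ∀ {n} E (α β : Exponent n) → weight E (α ⊕ β) ≡ weight E α + weight E β
  weight-⊕ {n} E α β = trans (cong₂ (λ d m → d + m * E ^ n) (digits-⊕ E α β) (sum-⊕ α β))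
    (regroup (digits E α) (digits E β) (sum α) (sum β) (E ^ n))
    where
    regroup : ∀ x y a b e → x + y + (a + b) * e ≡ x + a * e + (y + b * e)
    regroup = solve-∀

  digits-bound : ∀ {n} E .{{_ : NonZero E}} (α : Exponent n) → digits E α ≤ sum α * E ^ n
  digits-bound         E []      = z≤n
  digits-bound {suc n} E (a ∷ α) = begin
    a + digits E α * E                        ≤⟨ +-mono-≤ (m≤m*n a (E ^ suc n)) (*-monoˡ-≤ E (digits-bound E α)) ⟩
    a * E ^ suc n + sum α * E ^ n * E         ≡⟨ regroup a (sum α) E (E ^ n) ⟩
    (a + sum α) * E ^ suc n                   ∎
    where
    open ≤-Reasoning
    instance
      _ : NonZero (E ^ suc n)
      _ = m^n≢0 E (suc n)
    regroup : ∀ a b E e → a * (E * e) + b * e * E ≡ (a + b) * (E * e)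
    regroup = solve-∀

  weight-bound : ∀ {n} E .{{_ : NonZero E}} (α : Exponent n) → weight E α ≤ 2 * E ^ n * sum α
  weight-bound {n} E α = ≤-trans (+-monoˡ-≤ _ (digits-bound E α)) (≤-reflexive (regroup (sum α) (E ^ n)))
    where
    regroup : ∀ a e → a * e + a * e ≡ 2 * e * a
    regroup = solve-∀

  digits-< : ∀ {n E} {α : Exponent n} → All (_< E) α → digits E α < E ^ n
  digits-< []                              = s≤s z≤n
  digits-< {suc n} {E} {a ∷ α} (a<E ∷ α<) = begin-strict
    a + digits E α * E   <⟨ +-monoˡ-< _ a<E ⟩
    E + digits E α * E   ≤⟨ *-monoˡ-≤ E (digits-< α<) ⟩
    E ^ n * E            ≡⟨ *-comm (E ^ n) E ⟩
    E ^ suc n            ∎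
    where open ≤-Reasoning

  digits-injective : ∀ {n E} {α β : Exponent n} → All (_< E) α → All (_< E) β → digits E α ≡ digits E β → α ≡ β
  digits-injective []                                []         _  = refl
  digits-injective {α = a ∷ α} {b ∷ β} (a< ∷ α<) (b< ∷ β<) eq with a≡b , eq′ ← digits-unique _ _ a< b< eq =
    cong₂ _∷_ a≡b (digits-injective α< β< eq′)

  weight-injective : ∀ {n E} {α β : Exponent n} → All (_< E) α → All (_< E) β → weight E α ≡ weight E β → α ≡ β
  weight-injective {α = α} {β} α< β< eq =
    digits-injective α< β< (proj₁ (digits-unique (sum α) (sum β) (digits-< α<) (digits-< β<) eq))

  -- On the box `digits` stays below E^n, so the total degree of `β` is the quotient of its weight
  -- by E^n.
  weight-≤⇒sum-≤ : ∀ {n E} {α β : Exponent n} → All (_< E) β → weight E α ≤ weight E β → sum α ≤ sum β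
  weight-≤⇒sum-≤ {n} {E} {α} {β} β< le = s≤s⁻¹ (*-cancelʳ-< (E ^ n) (sum α) (suc (sum β)) (begin-strict
    sum α * E ^ n                ≤⟨ m≤n+m _ (digits E α) ⟩
    weight E α                   ≤⟨ le ⟩
    digits E β + sum β * E ^ n   <⟨ +-monoˡ-< _ (digits-< β<) ⟩
    E ^ n + sum β * E ^ n        ∎))
    where open ≤-Reasoning

  minimal : ∀ {A : Set} {U : A → Set} (U? : Decidable U) (f : A → ℕ) {xs x} → x ∈ xs → U x →
    ∃[ y ] y ∈ xs × U y × f y ≤ f x × (∀ z → z ∈ xs → U z → f y ≤ f z)
  minimal {U = U} U? f {xs} {x} x∈ Ux = y , proj₁ y-good , proj₂ y-good , f[argmin]≤f[⊤] {f = f} x good ,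
    λ z z∈ Uz → ListAll.lookup (f[argmin]≤f[xs] {f = f} x good) (∈-filter⁺ U? z∈ Uz)
    where
    good = filter U? xs
    -- The default `x` is itself a member satisfying `U`, so the result is good even if the default
    -- is returned, and it never exceeds `f x`.
    y = argmin f x good
    y-good : y ∈ xs × U y
    y-good with argmin-sel f x good
    ... | inj₁ y≡x = subst (λ y → y ∈ xs × U y) (sym y≡x) (x∈ , Ux)
    ... | inj₂ y∈  = ∈-filter⁻ U? y∈

-- Taylor expansion with Hasse derivatives in an affine chart.

module Taylor where

  open Exponents using (Exponent)
  open LatticeReduction using (monomial; sumOver; sumOver-cong; sumOver-*)
  open MonomialOrder using (box)
  open import Data.Nat as ℕ using (ℕ; zero; suc; _<_; s≤s; z≤n)
  import Data.Nat.Properties as ℕₚ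
  open import Data.Nat.Combinatorics using (_C_; k>n⇒nCk≡0; nCk+nC[k+1]≡[n+1]C[k+1])
  open import Data.Integer as ℤ using (ℤ; +_; _+_; _*_; _^_; 0ℤ; 1ℤ)
  import Data.Integer.Properties as ℤₚ
  open import Data.Integer.Tactic.RingSolver using (solve-∀)
  open import Data.List using (_++_; map; applyUpTo; cartesianProductWith)
  open import Data.List.Relation.Unary.All as ListAll using ([]; _∷_)
  open import Data.Vec using ([]; _∷_; lookup)
  open import Data.Vec.Functional using (insertAt)
  open import Data.Vec.Functional.Properties using (insertAt-lookup; insertAt-punchIn)
  open import Function using (id)

  sumBelow : ℕ → (ℕ → ℤ) → ℤ
  sumBelow zero    F = 0ℤ
  sumBelow (suc E) F = F 0 + sumBelow E (F ∘ suc)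

  sumBelow-cong : ∀ E {F G : ℕ → ℤ} → (∀ a → F a ≡ G a) → sumBelow E F ≡ sumBelow E G
  sumBelow-cong zero    eq = refl
  sumBelow-cong (suc E) eq = cong₂ _+_ (eq 0) (sumBelow-cong E (eq ∘ suc))

  sumBelow-zero : ∀ E {F : ℕ → ℤ} → (∀ a → F a ≡ 0ℤ) → sumBelow E F ≡ 0ℤ
  sumBelow-zero zero    eq = refl
  sumBelow-zero (suc E) eq = cong₂ _+_ (eq 0) (sumBelow-zero E (eq ∘ suc))

  sumBelow-linear : ∀ E c d (F G : ℕ → ℤ) → sumBelow E (λ a → c * F a + d * G a) ≡ c * sumBelow E F + d * sumBelow E G
  sumBelow-linear zero    c d F G = sym (cong₂ _+_ (ℤₚ.*-zeroʳ c) (ℤₚ.*-zeroʳ d))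
  sumBelow-linear (suc E) c d F G = trans (cong (λ h → c * F 0 + d * G 0 + h) (sumBelow-linear E c d (F ∘ suc) (G ∘ suc)))
    (regroup c d (F 0) (G 0) _ _)
    where
    regroup : ∀ c d f g x y → c * f + d * g + (c * x + d * y) ≡ c * (f + x) + d * (g + y)
    regroup = solve-∀

  sumBelow-*ʳ : ∀ E (F : ℕ → ℤ) c → sumBelow E (λ a → F a * c) ≡ sumBelow E F * c
  sumBelow-*ʳ zero    F c = refl
  sumBelow-*ʳ (suc E) F c = trans (cong (λ h → F 0 * c + h) (sumBelow-*ʳ E (F ∘ suc) c)) (sym (ℤₚ.*-distribʳ-+ c (F 0) _))

  -- The range is any `E` beyond `b`, the extra binomial coefficients being zero, so that monomials
  -- with different exponents can be expanded over one common range. The induction is Pascal's rule.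
  binomial : ∀ E b x y → b < E → (x + y) ^ b ≡ sumBelow E (λ a → + (b C a) * x ^ (b ℕ.∸ a) * y ^ a)
  binomial (suc E) zero    x y _ = sym (trans (cong (λ h → 1ℤ + h)
    (sumBelow-zero E λ a → cong (λ c → + c * 1ℤ * y ^ suc a) (k>n⇒nCk≡0 {0} {suc a} (s≤s z≤n)))) refl)
  binomial (suc E) (suc b) x y (s≤s b<E) = sym (begin
    1ℤ * (x * x ^ b) * 1ℤ + sumBelow E (λ a → + (suc b C suc a) * x ^ (b ℕ.∸ a) * (y * y ^ a))
      ≡⟨ cong (λ h → 1ℤ * (x * x ^ b) * 1ℤ + h) (trans (sumBelow-cong E pascal) (sumBelow-linear E x y _ _)) ⟩
    1ℤ * (x * x ^ b) * 1ℤ + (x * sumBelow E (λ a → t (suc a)) + y * sumBelow E t)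
      ≡⟨ regroup x (x ^ b) y _ _ ⟩
    x * sumBelow (suc E) t + y * sumBelow E t
      ≡⟨ cong₂ (λ f g → x * f + y * g) (binomial (suc E) b x y (ℕₚ.m≤n⇒m≤1+n b<E)) (binomial E b x y b<E) ⟨
    x * (x + y) ^ b + y * (x + y) ^ b
      ≡⟨ ℤₚ.*-distribʳ-+ ((x + y) ^ b) x y ⟨
    (x + y) * (x + y) ^ b ∎)
    where
    open ≡-Reasoning
    t : ℕ → ℤ
    t a = + (b C a) * x ^ (b ℕ.∸ a) * y ^ a
    regroup : ∀ x p y s r → 1ℤ * (x * p) * 1ℤ + (x * s + y * r) ≡ x * (1ℤ * p * 1ℤ + s) + y * r
    regroup = solve-∀
    expand₂ : ∀ c d p y q → (c + d) * p * (y * q) ≡ d * p * (y * q) + y * (c * p * q)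
    expand₂ = solve-∀
    pull : ∀ d x p q → d * (x * p) * q ≡ x * (d * p * q)
    pull = solve-∀
    lower : ∀ a → + (b C suc a) * x ^ (b ℕ.∸ a) * (y * y ^ a) ≡ x * t (suc a)
    lower a with ℕₚ.≤-<-connex b a
    -- Here truncated subtraction spoils the splitting of the power of `x`, but the binomial
    -- coefficient is zero.
    ... | inj₁ b≤a rewrite k>n⇒nCk≡0 {b} {suc a} (s≤s b≤a) = sym (ℤₚ.*-zeroʳ x)
    ... | inj₂ a<b = trans (cong (λ p → + (b C suc a) * p * (y * y ^ a)) (cong (x ^_) (ℕₚ.+-∸-assoc 1 a<b)))
                           (pull (+ (b C suc a)) x (x ^ (b ℕ.∸ suc a)) (y * y ^ a))
    pascal : ∀ a → + (suc b C suc a) * x ^ (b ℕ.∸ a) * (y * y ^ a) ≡ x * t (suc a) + y * t a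
    pascal a = begin
      + (suc b C suc a) * x ^ (b ℕ.∸ a) * (y * y ^ a)
        ≡⟨ cong (λ c → c * x ^ (b ℕ.∸ a) * (y * y ^ a))
             (trans (cong +_ (sym (nCk+nC[k+1]≡[n+1]C[k+1] b a))) (ℤₚ.pos-+ (b C a) (b C suc a))) ⟩
      (+ (b C a) + + (b C suc a)) * x ^ (b ℕ.∸ a) * (y * y ^ a)
        ≡⟨ expand₂ (+ (b C a)) (+ (b C suc a)) (x ^ (b ℕ.∸ a)) y (y ^ a) ⟩
      + (b C suc a) * x ^ (b ℕ.∸ a) * (y * y ^ a) + y * t a
        ≡⟨ cong (_+ y * t a) (lower a) ⟩
      x * t (suc a) + y * t a ∎

  sumOver-++ : ∀ {A : Set} (xs ys : List A) F → sumOver (xs ++ ys) F ≡ sumOver xs F + sumOver ys F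
  sumOver-++ []       ys F = sym (ℤₚ.+-identityˡ _)
  sumOver-++ (x ∷ xs) ys F = trans (cong (λ h → F x + h) (sumOver-++ xs ys F)) (sym (ℤₚ.+-assoc (F x) _ _))

  sumOver-map : ∀ {A B : Set} (f : A → B) xs F → sumOver (map f xs) F ≡ sumOver xs (F ∘ f)
  sumOver-map f []       F = refl
  sumOver-map f (x ∷ xs) F = cong (λ h → F (f x) + h) (sumOver-map f xs F)

  sumOver-linear : ∀ {A : Set} (xs : List A) c (F G : A → ℤ) →
    sumOver xs (λ α → c * F α + G α) ≡ c * sumOver xs F + sumOver xs G
  sumOver-linear []       c F G = sym (trans (ℤₚ.+-identityʳ _) (ℤₚ.*-zeroʳ c))
  sumOver-linear (α ∷ xs) c F G = trans (cong (λ h → c * F α + G α + h) (sumOver-linear xs c F G)) (regroup c (F α) (G α) _ _)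
    where
    regroup : ∀ c f g x y → c * f + g + (c * x + y) ≡ c * (f + x) + (g + y)
    regroup = solve-∀

  sumOver-box : ∀ n E (F : Exponent (suc n) → ℤ) →
    sumOver (box (suc n) E) F ≡ sumBelow E (λ a → sumOver (box n E) (λ β → F (a ∷ β)))
  sumOver-box n E F = go id E
    where
    -- `upTo` is `applyUpTo id`, whose recursion composes the function with `suc`; the statement
    -- therefore has to hold for an arbitrary `f`.
    go : ∀ (f : ℕ → ℕ) k → sumOver (cartesianProductWith _∷_ (applyUpTo f k) (box n E)) F ≡
                            sumBelow k (λ a → sumOver (box n E) (λ β → F (f a ∷ β)))
    go f zero    = refl
    go f (suc k) = trans (sumOver-++ (map (f 0 ∷_) (box n E)) _ F)
      (cong₂ _+_ (sumOver-map (f 0 ∷_) (box n E) F) (go (f ∘ suc) k))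

  Π-cong : ∀ n {F G : Fin n → ℤ} → (∀ i → F i ≡ G i) → Πℤ n F ≡ Πℤ n G
  Π-cong zero    eq = refl
  Π-cong (suc n) eq = cong₂ _*_ (eq zero) (Π-cong n (eq ∘ suc))

  Π-punchIn : ∀ n (k : Fin (suc n)) F → Πℤ (suc n) F ≡ F k * Πℤ n (F ∘ punchIn k)
  Π-punchIn n       zero    F = refl
  Π-punchIn (suc n) (suc k) F = trans (cong (F zero *_) (Π-punchIn n k (F ∘ suc))) (swap-front (F zero) (F (suc k)) _)
    where
    swap-front : ∀ a b c → a * (b * c) ≡ b * (a * c)
    swap-front = solve-∀

  hasseMonomial : ∀ {n} → Exps n → Exps n → (Fin n → ℤ) → ℤ
  hasseMonomial {n} β α x = Πℤ n (λ i → + (β i C α i) * x i ^ (β i ℕ.∸ α i))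

  multinomial : ∀ {n} E (b : Exps n) (x z : Fin n → ℤ) → (∀ i → b i < E) →
    Πℤ n (λ i → (x i + z i) ^ b i) ≡ sumOver (box n E) (λ α → hasseMonomial b (lookup α) x * monomial α z)
  multinomial {zero}  E b x z b< = refl
  multinomial {suc n} E b x z b< = sym (begin
    sumOver (box (suc n) E) (λ α → hasseMonomial b (lookup α) x * monomial α z)
      ≡⟨ sumOver-box n E _ ⟩
    sumBelow E (λ a → sumOver (box n E) (λ β → + (b zero C a) * x zero ^ (b zero ℕ.∸ a) * H β * (z zero ^ a * monomial β (z ∘ suc))))
      ≡⟨ sumBelow-cong E (λ a → trans (sumOver-cong (box n E) λ β _ →
           interchange (+ (b zero C a) * x zero ^ (b zero ℕ.∸ a)) (H β) (z zero ^ a) (monomial β (z ∘ suc)))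
           (sumOver-* (box n E) (+ (b zero C a) * x zero ^ (b zero ℕ.∸ a) * z zero ^ a) (λ β → H β * monomial β (z ∘ suc)))) ⟩
    sumBelow E (λ a → + (b zero C a) * x zero ^ (b zero ℕ.∸ a) * z zero ^ a * sumOver (box n E) (λ β → H β * monomial β (z ∘ suc)))
      ≡⟨ sumBelow-*ʳ E _ _ ⟩
    sumBelow E (λ a → + (b zero C a) * x zero ^ (b zero ℕ.∸ a) * z zero ^ a) * sumOver (box n E) (λ β → H β * monomial β (z ∘ suc))
      ≡⟨ cong₂ _*_ (binomial E (b zero) (x zero) (z zero) (b< zero)) (multinomial E (b ∘ suc) (x ∘ suc) (z ∘ suc) (b< ∘ suc)) ⟨
    (x zero + z zero) ^ b zero * Πℤ n (λ i → (x (suc i) + z (suc i)) ^ b (suc i)) ∎)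
    where
    open ≡-Reasoning
    H : Exponent n → ℤ
    H β = hasseMonomial (b ∘ suc) (lookup β) (x ∘ suc)
    interchange : ∀ a b c d → a * b * (c * d) ≡ a * c * (b * d)
    interchange = solve-∀

  -- The chart coordinate is never displaced, so only derivatives of order 0 in it occur.
  embed : ∀ {n} → Fin (suc n) → Exponent n → Exps (suc n)
  embed k α = insertAt (lookup α) k 0

  -- The undisplaced coordinate `k` contributes the constant factor `P k ^ β k`, which is also what
  -- the Hasse derivative of order 0 gives there. The other coordinates are expanded by
  -- `multinomial`.
  taylor-monomial : ∀ {n} E (k : Fin (suc n)) (β : Exps (suc n)) (P Q : Fin (suc n) → ℤ) (z : Fin n → ℤ) →
    (∀ i → β i < E) → Q k ≡ P k → (∀ i → Q (punchIn k i) ≡ P (punchIn k i) + z i) →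
    monoEval β Q ≡ sumOver (box n E) (λ α → hasseMonomial β (embed k α) P * monomial α z)
  taylor-monomial {n} E k β P Q z β< Qk Qi = begin
    monoEval β Q
      ≡⟨ Π-punchIn n k (λ i → Q i ^ β i) ⟩
    Q k ^ β k * Πℤ n (λ i → Q (punchIn k i) ^ β (punchIn k i))
      ≡⟨ cong₂ (λ q r → q ^ β k * r) Qk (Π-cong n λ i → cong (_^ β (punchIn k i)) (Qi i)) ⟩
    P k ^ β k * Πℤ n (λ i → (P (punchIn k i) + z i) ^ β (punchIn k i))
      ≡⟨ cong (P k ^ β k *_) (multinomial E (β ∘ punchIn k) (P ∘ punchIn k) z (β< ∘ punchIn k)) ⟩
    P k ^ β k * sumOver (box n E) (λ α → hasseMonomial (β ∘ punchIn k) (lookup α) (P ∘ punchIn k) * monomial α z)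
      ≡⟨ sumOver-* (box n E) (P k ^ β k) _ ⟨
    sumOver (box n E) (λ α → P k ^ β k * (hasseMonomial (β ∘ punchIn k) (lookup α) (P ∘ punchIn k) * monomial α z))
      ≡⟨ sumOver-cong (box n E) (λ α _ → trans (sym (ℤₚ.*-assoc (P k ^ β k) _ (monomial α z)))
           (cong (_* monomial α z) (sym (hasse-embed α)))) ⟩
    sumOver (box n E) (λ α → hasseMonomial β (embed k α) P * monomial α z) ∎
    where
    open ≡-Reasoning
    hasse-embed : ∀ α → hasseMonomial β (embed k α) P ≡ P k ^ β k * hasseMonomial (β ∘ punchIn k) (lookup α) (P ∘ punchIn k)
    hasse-embed α = trans (Π-punchIn n k (λ i → + (β i C embed k α i) * P i ^ (β i ℕ.∸ embed k α i))) (cong₂ _*_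
      (trans (cong (λ a → + (β k C a) * P k ^ (β k ℕ.∸ a)) (insertAt-lookup (lookup α) k 0)) (ℤₚ.*-identityˡ (P k ^ β k)))
      (Π-cong n λ i → cong (λ a → + (β (punchIn k i) C a) * P (punchIn k i) ^ (β (punchIn k i) ℕ.∸ a))
                           (insertAt-punchIn (lookup α) k 0 i)))

  Below : ∀ {n} → ℕ → Poly n → Set
  Below E = ListAll.All (λ (_ , β) → ∀ i → β i < E)

  taylor : ∀ {n} E (k : Fin (suc n)) (f : Poly (suc n)) (P Q : Fin (suc n) → ℤ) (z : Fin n → ℤ) →
    Below E f → Q k ≡ P k → (∀ i → Q (punchIn k i) ≡ P (punchIn k i) + z i) →
    eval f Q ≡ sumOver (box n E) (λ α → hasseEval f (embed k α) P * monomial α z)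
  taylor {n} E k []            P Q z []        Qk Qi = sym (vanish (box n E))
    where
    vanish : ∀ (xs : List (Exponent n)) → sumOver xs (λ α → 0ℤ * monomial α z) ≡ 0ℤ
    vanish []       = refl
    vanish (_ ∷ xs) = trans (ℤₚ.+-identityˡ _) (vanish xs)
  taylor {n} E k ((c , β) ∷ f) P Q z (β< ∷ f<) Qk Qi = begin
    c * monoEval β Q + eval f Q
      ≡⟨ cong₂ (λ a b → c * a + b) (taylor-monomial E k β P Q z β< Qk Qi) (taylor E k f P Q z f< Qk Qi) ⟩
    c * sumOver (box n E) (λ α → hasseMonomial β (embed k α) P * monomial α z) +
        sumOver (box n E) (λ α → hasseEval f (embed k α) P * monomial α z)
      ≡⟨ sumOver-linear (box n E) c _ _ ⟨
    sumOver (box n E) (λ α → c * (hasseMonomial β (embed k α) P * monomial α z) + hasseEval f (embed k α) P * monomial α z)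
      ≡⟨ sumOver-cong (box n E) (λ α _ → factor c (hasseMonomial β (embed k α) P) (monomial α z) (hasseEval f (embed k α) P)) ⟩
    sumOver (box n E) (λ α → hasseEval ((c , β) ∷ f) (embed k α) P * monomial α z) ∎
    where
    open ≡-Reasoning
    factor : ∀ c a m b → c * (a * m) + b * m ≡ (c * a + b) * m
    factor = solve-∀

-- Congruences, inverses of units, and local coordinates around P.

module LocalCoordinate where

  open AlternatingForms
  open Exponents using (Exponent; h; nonMultiples; gap; gap-nonMultiples)
  open LatticeReduction
  open MonomialOrder
  open Taylor
  open import Data.Nat as ℕ using (ℕ; zero; suc; _≤_; s≤s)
  import Data.Nat.Properties as ℕₚ
  import Data.Nat.Divisibility as ℕ∣
  open import Data.Nat.Combinatorics using (_C_)
  open import Data.Nat.Tactic.RingSolver using () renaming (solve-∀ to ℕ-solve-∀)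
  open import Data.Nat.Primality using (Prime; euclidsLemma; prime⇒irreducible)
  open import Data.Nat.Coprimality using (Coprime; coprime-Bézout)
  open import Data.Nat.GCD using (module Bézout)
  open import Data.Integer as ℤ using (ℤ; +_; -_; ∣_∣; _+_; _*_; _-_; _^_; 0ℤ; 1ℤ)
  import Data.Integer.Properties as ℤₚ
  open import Data.Integer.Divisibility.Signed as ℤ∣ using (_∣_; divides; ∣ᵤ⇒∣; ∣⇒∣ᵤ)
  open import Data.Integer.Tactic.RingSolver using (solve-∀)
  open import Data.Fin using (punchOut; _≟_)
  open import Data.Fin.Properties using (punchIn-punchOut)
  open import Data.List.Relation.Unary.All using ([]; _∷_)
  open import Data.Vec using ([]; _∷_; sum; tabulate)
  open import Data.Vec.Relation.Unary.All using ([]; _∷_)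
  open import Data.Vec.Functional using (insertAt)
  open import Data.Vec.Functional.Properties using (insertAt-lookup; insertAt-punchIn)
  open import Data.Empty using (⊥-elim)

  module Congruence (n : ℤ) where

    infix 4 _≈_
    record _≈_ (a b : ℤ) : Set where
      constructor congruent
      field difference : n ∣ a - b
    open _≈_ public

    ≈-reflexive : ∀ {a b} → a ≡ b → a ≈ b
    ≈-reflexive {a} refl = congruent (divides 0ℤ (trans (ℤₚ.+-inverseʳ a) (sym (ℤₚ.*-zeroˡ n))))

    ≈-refl : ∀ {a} → a ≈ a
    ≈-refl = ≈-reflexive refl

    ≈-sym : ∀ {a b} → a ≈ b → b ≈ a
    ≈-sym {a} {b} (congruent d) = congruent (subst (n ∣_) (flip a b) (ℤ∣.∣m⇒∣-m d))
      where
      flip : ∀ a b → - (a + - b) ≡ b + - a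
      flip = solve-∀

    ≈-trans : ∀ {a b c} → a ≈ b → b ≈ c → a ≈ c
    ≈-trans {a} {b} {c} (congruent d) (congruent e) = congruent (subst (n ∣_) (add a b c) (ℤ∣.∣m∣n⇒∣m+n d e))
      where
      add : ∀ a b c → a + - b + (b + - c) ≡ a + - c
      add = solve-∀

    +-cong : ∀ {a b c d} → a ≈ b → c ≈ d → a + c ≈ b + d
    +-cong {a} {b} {c} {d} (congruent x) (congruent y) = congruent (subst (n ∣_) (add a b c d) (ℤ∣.∣m∣n⇒∣m+n x y))
      where
      add : ∀ a b c d → a + - b + (c + - d) ≡ a + c + - (b + d)
      add = solve-∀

    *-cong : ∀ {a b c d} → a ≈ b → c ≈ d → a * c ≈ b * d
    *-cong {a} {b} {c} {d} (congruent x) (congruent y) =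
      congruent (subst (n ∣_) (mul a b c d) (ℤ∣.∣m∣n⇒∣m+n (ℤ∣.∣n⇒∣m*n c x) (ℤ∣.∣n⇒∣m*n b y)))
      where
      mul : ∀ a b c d → c * (a + - b) + b * (c + - d) ≡ a * c + - (b * d)
      mul = solve-∀

    ^-cong : ∀ {a b} k → a ≈ b → a ^ k ≈ b ^ k
    ^-cong zero    eq = ≈-refl
    ^-cong (suc k) eq = *-cong eq (^-cong k eq)

    monoEval-cong : ∀ {m} (β : Exps m) {x y} → (∀ i → x i ≈ y i) → monoEval β x ≈ monoEval β y
    monoEval-cong {zero}  β eq = ≈-refl
    monoEval-cong {suc m} β eq = *-cong (^-cong (β zero) (eq zero)) (monoEval-cong (β ∘ suc) (eq ∘ suc))

    eval-cong : ∀ {m} (f : Poly m) {x y} → (∀ i → x i ≈ y i) → eval f x ≈ eval f y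
    eval-cong []            eq = ≈-refl
    eval-cong ((c , β) ∷ f) eq = +-cong (*-cong (≈-refl {c}) (monoEval-cong β eq)) (eval-cong f eq)

    one-^ : ∀ {a} k → a ≈ 1ℤ → a ^ k ≈ 1ℤ
    one-^ {a} k eq = ≈-trans (^-cong k eq) (≈-reflexive (ℤₚ.^-zeroˡ k))

    divisible⇒≈0 : ∀ {a} → n ∣ a → a ≈ 0ℤ
    divisible⇒≈0 {a} d = congruent (subst (n ∣_) (sym (ℤₚ.+-identityʳ a)) d)

    ≈0⇒divisible : ∀ {a} → a ≈ 0ℤ → n ∣ a
    ≈0⇒divisible {a} (congruent d) = subst (n ∣_) (ℤₚ.+-identityʳ a) d

  weighted-monoEval : ∀ {n} (w β : Exps n) t x → monoEval β (λ i → t ^ w i * x i) ≡ t ^ wdeg w β * monoEval β x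
  weighted-monoEval {zero}  w β t x = refl
  weighted-monoEval {suc n} w β t x = begin
    (t ^ w zero * x zero) ^ β zero * monoEval (β ∘ suc) (λ i → t ^ w (suc i) * x (suc i))
      ≡⟨ cong₂ _*_ (^-*-distrib (t ^ w zero) (x zero) (β zero)) (weighted-monoEval (w ∘ suc) (β ∘ suc) t (x ∘ suc)) ⟩
    (t ^ w zero) ^ β zero * x zero ^ β zero * (t ^ wdeg (w ∘ suc) (β ∘ suc) * monoEval (β ∘ suc) (x ∘ suc))
      ≡⟨ cong (λ q → q * x zero ^ β zero * (t ^ wdeg (w ∘ suc) (β ∘ suc) * monoEval (β ∘ suc) (x ∘ suc)))
           (trans (ℤₚ.^-*-assoc t (w zero) (β zero)) (cong (t ^_) (ℕₚ.*-comm (w zero) (β zero)))) ⟩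
    t ^ (β zero ℕ.* w zero) * x zero ^ β zero * (t ^ wdeg (w ∘ suc) (β ∘ suc) * monoEval (β ∘ suc) (x ∘ suc))
      ≡⟨ interchange (t ^ (β zero ℕ.* w zero)) (x zero ^ β zero) (t ^ wdeg (w ∘ suc) (β ∘ suc)) (monoEval (β ∘ suc) (x ∘ suc)) ⟩
    t ^ (β zero ℕ.* w zero) * t ^ wdeg (w ∘ suc) (β ∘ suc) * monoEval β x
      ≡⟨ cong (_* monoEval β x) (ℤₚ.^-distribˡ-+-* t (β zero ℕ.* w zero) _) ⟨
    t ^ wdeg w β * monoEval β x ∎
    where
    open ≡-Reasoning
    interchange : ∀ a b c d → a * b * (c * d) ≡ a * c * (b * d)
    interchange = solve-∀

  weighted-eval : ∀ {n w d} {f : Poly n} → WHomog w d f → ∀ t x → eval f (λ i → t ^ w i * x i) ≡ t ^ d * eval f x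
  weighted-eval {d = d} [] t x = sym (ℤₚ.*-zeroʳ (t ^ d))
  weighted-eval {w = w} {d} (_∷_ {c} {β} {f} refl hom) t x =
    trans (cong₂ (λ a b → c * a + b) (weighted-monoEval w β t x) (weighted-eval hom t x))
      (factor c (t ^ d) (monoEval β x) (eval f x))
    where
    factor : ∀ c q a b → c * (q * a) + q * b ≡ q * (c * a + b)
    factor = solve-∀

  hasseEval-cong : ∀ {n} (f : Poly n) {α α′ : Exps n} x → (∀ i → α i ≡ α′ i) → hasseEval f α x ≡ hasseEval f α′ x
  hasseEval-cong []                x eq = refl
  hasseEval-cong {n} ((c , β) ∷ f) x eq = cong₂ (λ a b → c * a + b)
    (Π-cong n λ i → cong (λ a → + (β i C a) * x i ^ (β i ℕ.∸ a)) (eq i)) (hasseEval-cong f x eq)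

  hasseEval-zero : ∀ {n} (f : Poly n) x → hasseEval f (λ _ → 0) x ≡ eval f x
  hasseEval-zero []                x = refl
  hasseEval-zero {n} ((c , β) ∷ f) x = cong₂ (λ a b → c * a + b)
    (Π-cong n λ i → ℤₚ.*-identityˡ (x i ^ β i)) (hasseEval-zero f x)

  Σℕ-punchIn : ∀ n (k : Fin (suc n)) α → Σℕ (suc n) α ≡ α k ℕ.+ Σℕ n (α ∘ punchIn k)
  Σℕ-punchIn n       zero    α = refl
  Σℕ-punchIn (suc n) (suc k) α = trans (cong (α zero ℕ.+_) (Σℕ-punchIn n k (α ∘ suc))) (swap-front (α zero) (α (suc k)) _)
    where
    swap-front : ∀ a b c → a ℕ.+ (b ℕ.+ c) ≡ b ℕ.+ (a ℕ.+ c)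
    swap-front = ℕ-solve-∀

  ≤Σℕ : ∀ {n} (α : Exps n) i → α i ≤ Σℕ n α
  ≤Σℕ α zero    = ℕₚ.m≤m+n _ _
  ≤Σℕ α (suc i) = ℕₚ.≤-trans (≤Σℕ (α ∘ suc) i) (ℕₚ.m≤n+m _ (α zero))

  sum-tabulate : ∀ {n} (α : Exps n) → sum (tabulate α) ≡ Σℕ n α
  sum-tabulate {zero}  α = refl
  sum-tabulate {suc n} α = cong (α zero ℕ.+_) (sum-tabulate (α ∘ suc))

  below-some : ∀ {n} (f : Poly n) B → ∃[ E ] (B ≤ E × Below E f)
  below-some []                B = B , ℕₚ.≤-refl , []
  below-some {n} ((c , β) ∷ f) B with E , bound , f< ← below-some f (B ℕ.⊔ suc (Σℕ n β)) =
    E , ℕₚ.≤-trans (ℕₚ.m≤m⊔n B _) bound ,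
    (λ i → ℕₚ.≤-trans (s≤s (≤Σℕ β i)) (ℕₚ.≤-trans (ℕₚ.m≤n⊔m B _) bound)) ∷ f<

  punchIn-cases : ∀ {n} (k i : Fin (suc n)) → i ≡ k ⊎ (∃[ j ] i ≡ punchIn k j)
  punchIn-cases {n} k i with k ≟ i
  ... | yes k≡i = inj₁ (sym k≡i)
  punchIn-cases {zero}  zero zero | no k≢i = ⊥-elim (k≢i refl)
  punchIn-cases {suc n} k    i    | no k≢i = inj₂ (punchOut k≢i , sym (punchIn-punchOut k≢i))

  insertAt-elim : ∀ {A : Set} {n} (R : Fin (suc n) → A → Set) (xs : Fin n → A) k v →
    R k v → (∀ i → R (punchIn k i) (xs i)) → ∀ i → R i (insertAt xs k v i)
  insertAt-elim R xs k v Rk Rxs i with punchIn-cases k i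
  ... | inj₁ refl       = subst (R k) (sym (insertAt-lookup xs k v)) Rk
  ... | inj₂ (i′ , refl) = subst (R (punchIn k i′)) (sym (insertAt-punchIn xs k v i′)) (Rxs i′)

  abs-^ : ∀ p N → ∣ (+ p) ^ N ∣ ≡ p ℕ.^ N
  abs-^ p zero    = refl
  abs-^ p (suc N) = trans (ℤₚ.abs-* (+ p) ((+ p) ^ N)) (cong (p ℕ.*_) (abs-^ p N))

  module Units (p : ℕ) (p-prime : Prime p) where

    Unit : ℤ → Set
    Unit a = ¬ (+ p) ∣ a

    -- Bézout's identity over the natural numbers has two forms, according to which multiple is the
    -- larger one. This decides the sign of the inverse, and the sign of `a` is restored afterwards.
    inverse-of-abs : ∀ {a} → Unit a → ∃[ v ] (+ p) ∣ 1ℤ + - (v * + ∣ a ∣)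
    inverse-of-abs {a} unit with coprime-Bézout coprime
      where
      coprime : Coprime p ∣ a ∣
      coprime (d∣p , d∣a) with prime⇒irreducible p-prime d∣p
      ... | inj₁ d≡1  = d≡1
      ... | inj₂ refl = ⊥-elim (unit (∣ᵤ⇒∣ d∣a))
    ... | Bézout.+- x y eq = - + y , divides (+ x) (trans (move (+ y) (+ ∣ a ∣)) (begin
        1ℤ + + y * + ∣ a ∣    ≡⟨ cong (λ t → 1ℤ + t) (ℤₚ.pos-* y ∣ a ∣) ⟨
        + (1 ℕ.+ y ℕ.* ∣ a ∣) ≡⟨ cong +_ eq ⟩
        + (x ℕ.* p)           ≡⟨ ℤₚ.pos-* x p ⟩
        + x * + p             ∎))
      where
      open ≡-Reasoning
      move : ∀ y b → 1ℤ + - (- y * b) ≡ 1ℤ + y * b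
      move = solve-∀
    ... | Bézout.-+ x y eq = + y , divides (- + x) (begin
        1ℤ + - (+ y * + ∣ a ∣)     ≡⟨ cong (λ t → 1ℤ + - t) (ℤₚ.pos-* y ∣ a ∣) ⟨
        1ℤ + - + (y ℕ.* ∣ a ∣)     ≡⟨ cong (λ t → 1ℤ + - + t) eq ⟨
        1ℤ + - (1ℤ + + (x ℕ.* p))  ≡⟨ cong (λ t → 1ℤ + - (1ℤ + t)) (ℤₚ.pos-* x p) ⟩
        1ℤ + - (1ℤ + + x * + p)    ≡⟨ cancel (+ x) (+ p) ⟩
        - + x * + p                ∎)
      where
      open ≡-Reasoning
      cancel : ∀ x p → 1ℤ + - (1ℤ + x * p) ≡ - x * p
      cancel = solve-∀

    inverse-mod-p : ∀ {a} → Unit a → ∃[ v ] (+ p) ∣ 1ℤ + - (v * a)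
    inverse-mod-p {a} unit with v , d ← inverse-of-abs unit | ℤₚ.+∣i∣≡i⊎+∣i∣≡-i a
    ... | inj₁ eq = v , subst (λ b → (+ p) ∣ 1ℤ + - (v * b)) eq d
    ... | inj₂ eq = - v , subst ((+ p) ∣_) (neg v a) (subst (λ b → (+ p) ∣ 1ℤ + - (v * b)) eq d)
      where
      neg : ∀ v a → 1ℤ + - (v * - a) ≡ 1ℤ + - (- v * a)
      neg = solve-∀

    -- Newton iteration: 1 - v′ a = (1 - v₁ a) (1 - v a) for v′ = v + v₁ (1 - v a).
    inverse : ∀ k {a} → Unit a → ∃[ v ] (+ p) ^ k ∣ 1ℤ + - (v * a)
    inverse zero    {a} unit = 0ℤ , divides 1ℤ refl
    inverse (suc k) {a} unit with v₁ , d₁ ← inverse-mod-p unit | v , d ← inverse k unit =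
      v + v₁ * (1ℤ + - (v * a)) , subst ((+ p) ^ suc k ∣_) (newton v v₁ a)
        (ℤ∣.∣-trans (ℤ∣.*-monoˡ-∣ ((+ p) ^ k) d₁) (ℤ∣.*-monoʳ-∣ (1ℤ + - (v₁ * a)) d))
      where
      newton : ∀ v w a → (1ℤ + - (w * a)) * (1ℤ + - (v * a)) ≡ 1ℤ + - ((v + w * (1ℤ + - (v * a))) * a)
      newton = solve-∀

    unit-* : ∀ {a b} → Unit a → Unit b → Unit (a * b)
    unit-* {a} {b} ua ub d with euclidsLemma ∣ a ∣ ∣ b ∣ p-prime (subst (p ℕ∣.∣_) (ℤₚ.abs-* a b) (∣⇒∣ᵤ d))
    ... | inj₁ p∣a = ua (∣ᵤ⇒∣ p∣a)
    ... | inj₂ p∣b = ub (∣ᵤ⇒∣ p∣b)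

    mod⇒∣ : ∀ {a} → a ≡ + 0 [mod p ] → (+ p) ∣ a
    mod⇒∣ {a} d = subst ((+ p) ∣_) (ℤₚ.+-identityʳ a) (∣ᵤ⇒∣ d)

    ∣⇒mod : ∀ {a} → (+ p) ∣ a → a ≡ + 0 [mod p ]
    ∣⇒mod {a} d = ∣⇒∣ᵤ (subst ((+ p) ∣_) (sym (ℤₚ.+-identityʳ a)) d)

    -- With ν = ξ_j / P_j the tuple (ν^(-w_i) ξ_i) has j-th coordinate P_j and is congruent to P modulo p.
    record LocalCoordinates {n} (w : Exps (suc n)) (q : ℤ) (j : Fin (suc n)) (P ξ : Fin (suc n) → ℤ) : Set where
      open Congruence q
      field
        ν μ     : ℤ
        y       : Fin n → ℤ
        νμ      : ν * μ ≈ 1ℤ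
        point-≈ : ∀ i → insertAt (λ i → P (punchIn j i) + + p * y i) j (P j) i ≈ μ ^ w i * ξ i
      point : Fin (suc n) → ℤ
      point = insertAt (λ i → P (punchIn j i) + + p * y i) j (P j)

    -- `a` and `b` play the roles of 1 / P_j and 1 / ξ_j modulo `q`, so `ν` and `μ` are the ratios
    -- ξ_j / P_j and P_j / ξ_j.
    module Rescaling {n} {w : Exps (suc n)} {q} (p∣q : (+ p) ∣ q) {j} {P ξ : Fin (suc n) → ℤ} (wj≡1 : w j ≡ 1)
      {λ′} (reduces : ∀ i → ξ i ≡ λ′ ^ w i * P i [mod p ])
      {a b} (aP : Congruence._≈_ q (a * P j) 1ℤ) (bξ : Congruence._≈_ q (b * ξ j) 1ℤ) where

      module p = Congruence (+ p)
      open Congruence q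

      first-power : ∀ t → t ^ w j ≡ t
      first-power t = trans (cong (t ^_) wj≡1) (ℤₚ.^-identityʳ t)

      reduces-p : ∀ i → ξ i p.≈ λ′ ^ w i * P i
      reduces-p i = p.congruent (∣ᵤ⇒∣ (reduces i))

      ν μ : ℤ
      ν = ξ j * a
      μ = P j * b

      νμ : ν * μ ≈ 1ℤ
      νμ = ≈-trans (≈-reflexive (rearrange (ξ j) a (P j) b)) (*-cong bξ aP)
        where
        rearrange : ∀ x a q b → x * a * (q * b) ≡ (b * x) * (a * q)
        rearrange = solve-∀

      -- As the chart coordinate has weight 1, ξ_j is λ′ P_j modulo `p`; hence `μ` undoes modulo `p`
      -- the scaling by which `ξ` reduces to `P`.
      μλ′ : μ * λ′ p.≈ 1ℤ
      μλ′ = p.≈-trans (p.≈-reflexive (rearrange (P j) b λ′))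
        (p.≈-trans (p.*-cong (p.≈-refl {b}) (p.≈-sym
            (p.≈-trans (reduces-p j) (p.≈-reflexive (cong (_* P j) (first-power λ′))))))
          (p.congruent (ℤ∣.∣-trans p∣q (difference bξ))))
        where
        rearrange : ∀ q b l → q * b * l ≡ b * (l * q)
        rearrange = solve-∀

      scaled-≈ : ∀ i → μ ^ w i * ξ i p.≈ P i
      scaled-≈ i = p.≈-trans (p.*-cong (p.≈-refl {μ ^ w i}) (reduces-p i))
        (p.≈-trans (p.≈-reflexive (trans (sym (ℤₚ.*-assoc (μ ^ w i) (λ′ ^ w i) (P i)))
                                         (cong (_* P i) (sym (^-*-distrib μ λ′ (w i))))))
          (p.≈-trans (p.*-cong (p.one-^ (w i) μλ′) (p.≈-refl {P i})) (p.≈-reflexive (ℤₚ.*-identityˡ (P i)))))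

      y : Fin n → ℤ
      y i = _∣_.quotient (p.difference (scaled-≈ (punchIn j i)))

      restore : ∀ a π y x → x + - a ≡ y * π → a + π * y ≡ x
      restore a π y x eq = trans (cong (λ t → a + t) (trans (ℤₚ.*-comm π y) (sym eq))) (cancel a x)
        where
        cancel : ∀ a x → a + (x + - a) ≡ x
        cancel = solve-∀

      -- Only this coordinate is replaced by a congruent value: the others equal μ^(w i) ξ_i
      -- exactly, while here the value is set to P_j so that the Taylor expansion has no
      -- displacement along `j`.
      chart-≈ : P j ≈ μ ^ w j * ξ j
      chart-≈ = ≈-trans (≈-reflexive (sym (ℤₚ.*-identityʳ (P j))))
        (≈-trans (*-cong (≈-refl {P j}) (≈-sym bξ))
          (≈-reflexive (trans (sym (ℤₚ.*-assoc (P j) b (ξ j))) (cong (_* ξ j) (sym (first-power μ))))))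

      point-≈ : ∀ i → insertAt (λ i → P (punchIn j i) + + p * y i) j (P j) i ≈ μ ^ w i * ξ i
      point-≈ = insertAt-elim (λ i x → x ≈ μ ^ w i * ξ i) (λ i → P (punchIn j i) + + p * y i) j (P j) chart-≈
        λ i → ≈-reflexive (restore (P (punchIn j i)) (+ p) (y i) (μ ^ w (punchIn j i) * ξ (punchIn j i))
          (_∣_.equality (p.difference (scaled-≈ (punchIn j i)))))

    -- Modulo `p` the coordinate ξ_j is λ′ P_j, a product of two units.
    coordinate-unit : ∀ {n} {w : Exps (suc n)} {j} {P ξ : Fin (suc n) → ℤ} → w j ≡ 1 → Unit (P j) →
      ReducesTo w p ξ P → Unit (ξ j)
    coordinate-unit {j = j} {P} {ξ} wj≡1 P-unit (λ′ , λ′-unit , reduces) d = unit-* {λ′} (λ′-unit ∘ ∣⇒mod) P-unit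
      (subst (λ e → (+ p) ∣ e * P j) (trans (cong (λ′ ^_) wj≡1) (ℤₚ.^-identityʳ λ′))
        (p.≈0⇒divisible (p.≈-trans (p.≈-sym (p.congruent (∣ᵤ⇒∣ (reduces j)))) (p.divisible⇒≈0 d))))
      where module p = Congruence (+ p)

    rescale : ∀ {n} {w : Exps (suc n)} {q j} {P ξ : Fin (suc n) → ℤ} → (+ p) ∣ q → w j ≡ 1 → ReducesTo w p ξ P →
      ∃[ a ] q ∣ 1ℤ + - (a * P j) → ∃[ b ] q ∣ 1ℤ + - (b * ξ j) → LocalCoordinates w q j P ξ
    rescale {w = w} {q} {j} {P} {ξ} p∣q wj≡1 (λ′ , _ , reduces) (a , aP) (b , bξ) =
      record { ν = ν ; μ = μ ; y = y ; νμ = νμ ; point-≈ = point-≈ }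
      where
      open Congruence q
      open Rescaling {w = w} {q} p∣q {j} {P} {ξ} wj≡1 {λ′} reduces {a} {b} (≈-sym (congruent aP)) (≈-sym (congruent bξ))

    -- The modulus is p^(k + 1) so that `p` divides it even for k = 0; congruences modulo `q` can
    -- then be read modulo `p` in `Rescaling`.
    localCoordinates : ∀ {n} {w : Exps (suc n)} k {j} {P ξ : Fin (suc n) → ℤ} → w j ≡ 1 → Unit (P j) →
      ReducesTo w p ξ P → LocalCoordinates w ((+ p) ^ suc k) j P ξ
    localCoordinates {w = w} k {j} {P} {ξ} wj≡1 P-unit ξ↦P = rescale {w = w} (ℤ∣.∣m⇒∣m*n ((+ p) ^ k) ℤ∣.∣-refl) wj≡1 ξ↦P
      (inverse (suc k) P-unit) (inverse (suc k) (coordinate-unit {w = w} {j} {P} {ξ} wj≡1 P-unit ξ↦P))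

-- The choice of k and the numerical bound.

module Estimates where

  open Exponents using (h; h-mono; h-absorb)
  open import Data.Nat as ℕ using (ℕ; zero; suc; _+_; _*_; _^_; _!; _≤_; _<_; z≤n; s≤s; NonZero)
  open import Data.Nat.Properties
  open import Data.Nat.Tactic.RingSolver using (solve-∀)

  -- The left side is the product of the `n` consecutive integers from t + 1 to t + n.
  h-factorial : ∀ n t → n ! * h n (suc t) ≤ (t + n) ^ n
  h-factorial zero    t = ≤-refl
  h-factorial (suc n) t = begin
    suc n * n ! * h (suc n) (suc t)      ≡⟨ regroup (suc n) (n !) (h (suc n) (suc t)) ⟩
    n ! * (suc n * h (suc n) (suc t))    ≡⟨ cong (n ! *_) (h-absorb n (suc t)) ⟩
    n ! * ((suc t + n) * h n (suc t))    ≡⟨ regroup₂ (n !) (suc t + n) (h n (suc t)) ⟩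
    (suc t + n) * (n ! * h n (suc t))    ≤⟨ *-monoʳ-≤ (suc t + n) (h-factorial n t) ⟩
    (suc t + n) * (t + n) ^ n            ≤⟨ *-monoʳ-≤ (suc t + n) (^-monoˡ-≤ n (n≤1+n (t + n))) ⟩
    (suc t + n) ^ suc n                  ≡⟨ cong (_^ suc n) (sym (+-suc t n)) ⟩
    (t + suc n) ^ suc n                  ∎
    where
    open ≤-Reasoning
    regroup : ∀ a b c → a * b * c ≡ b * (a * c)
    regroup = solve-∀
    regroup₂ : ∀ a b c → a * (b * c) ≡ b * (a * c)
    regroup₂ = solve-∀

  h-unbounded : ∀ n t → t ≤ h (suc n) t
  h-unbounded n zero    = z≤n
  h-unbounded n (suc t) = +-mono-≤ (positive n t) (h-unbounded n t)
    where
    positive : ∀ n t → 1 ≤ h n (suc t)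
    positive zero    t = ≤-refl
    positive (suc n) t = ≤-trans (positive n t) (m≤m+n _ _)

  -- A discrete intermediate value argument, searching downwards from `n`; it works for any `g`,
  -- monotone or not.
  crossing : ∀ (g : ℕ → ℕ) s n → g 0 ≤ s → s < g n → ∃[ k ] (g k ≤ s × s < g (suc k))
  crossing g s zero    g0≤s s<g = contradiction (≤-<-trans g0≤s s<g) (<-irrefl refl)
  crossing g s (suc n) g0≤s s<g with ≤-<-connex (g n) s
  ... | inj₁ gn≤s = n , gn≤s , s<g
  ... | inj₂ s<gn = crossing g s n g0≤s s<gn

  -- k s - m C(k + r, r + 1) is concave in k; the k chosen here is where its increment s - m C(k + r, r) changes sign.
  optimal-degree : ∀ r m s → 1 ≤ r → 1 ≤ m → ∃[ k ] (m * h r k ≤ s × s < m * h r (suc k))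
  -- The search starts with value 0 at k = 0, where `h (suc r) 0` vanishes, and ends at k = s + 1,
  -- where the value exceeds `s` by `h-unbounded`.
  optimal-degree (suc r) (suc m) s _ _ = crossing (λ k → suc m * h (suc r) k) s (suc s)
    (≤-trans (≤-reflexive (*-zeroʳ (suc m))) z≤n)
    (≤-trans (h-unbounded r (suc s)) (m≤m+n _ _))

  *-positive : ∀ {a b} → 1 ≤ a → 1 ≤ b → 1 ≤ a * b
  *-positive = *-mono-≤

  power-*-distrib : ∀ a b n → (a * b) ^ n ≡ a ^ n * b ^ n
  power-*-distrib a b zero    = refl
  power-*-distrib a b (suc n) = trans (cong (a * b *_) (power-*-distrib a b n)) (interchange a b (a ^ n) (b ^ n))
    where
    interchange : ∀ a b c d → a * b * (c * d) ≡ a * c * (b * d)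
    interchange = solve-∀

  -- This is the desired inequality with the r-th root and the denominator r + 1 cleared. The upper
  -- side of the crossing supplies k + r, and the strict sign; the lower side controls the loss.
  bound-ℕ : ∀ r m s k N → 1 ≤ r → 1 ≤ s → m * h r k ≤ s → s < m * h r (suc k) → k * s ≤ N + m * h (suc r) k →
    r ! * (r ^ r * s ^ suc r) < m * (suc r * (N + r * s)) ^ r
  bound-ℕ r m s k N 1≤r 1≤s low high ks≤ = begin-strict
    r ! * (r ^ r * (s * s ^ r))            ≡⟨ regroup (r !) (r ^ r) s (s ^ r) ⟩
    r ! * r ^ r * s ^ r * s                <⟨ *-monoʳ-< (r ! * r ^ r * s ^ r) high ⟩
    r ! * r ^ r * s ^ r * (m * h r (suc k)) ≡⟨ regroup₂ (r !) (r ^ r) (s ^ r) m (h r (suc k)) ⟩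
    m * (r ^ r * (r ! * h r (suc k) * s ^ r)) ≤⟨ *-monoʳ-≤ m (*-monoʳ-≤ (r ^ r) (*-monoˡ-≤ (s ^ r) (h-factorial r k))) ⟩
    m * (r ^ r * ((k + r) ^ r * s ^ r))
      ≡⟨ cong (m *_) (trans (power-*-distrib r ((k + r) * s) r) (cong (r ^ r *_) (power-*-distrib (k + r) s r))) ⟨
    m * (r * ((k + r) * s)) ^ r            ≤⟨ *-monoʳ-≤ m (^-monoˡ-≤ r linear) ⟩
    m * (suc r * (N + r * s)) ^ r          ∎
    where
    open ≤-Reasoning
    instance
      nz : NonZero (r ! * r ^ r * s ^ r)
      nz = ℕ.>-nonZero (*-positive (*-positive (1≤n! r) (m^n>0 r r)) (m^n>0 s r))
        where
        instance
          _ : NonZero r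
          _ = ℕ.>-nonZero 1≤r
          _ : NonZero s
          _ = ℕ.>-nonZero 1≤s
    regroup : ∀ f a s b → f * (a * (s * b)) ≡ f * a * b * s
    regroup = solve-∀
    regroup₂ : ∀ f a b m x → f * a * b * (m * x) ≡ m * (a * (f * x * b))
    regroup₂ = solve-∀
    regroup₃ : ∀ r k s → r * ((k + r) * s) + (k + r) * s ≡ suc r * (k * s) + suc r * (r * s)
    regroup₃ = solve-∀
    regroup₄ : ∀ r N m x s → suc r * (N + m * x) + suc r * (r * s) ≡ suc r * (N + r * s) + m * (suc r * x)
    regroup₄ = solve-∀
    regroup₅ : ∀ a m x → m * (a * x) ≡ a * (m * x)
    regroup₅ = solve-∀
    -- Absorption turns (r + 1) times the loss into (k + r) m h_r(k), which is at most (k + r) s.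
    -- One of the r + 1 copies of (k + r) s is thereby spent and r remain: this is the factor r / (r
    -- + 1).
    linear : r * ((k + r) * s) ≤ suc r * (N + r * s)
    linear = +-cancelʳ-≤ ((k + r) * s) _ _ (begin
      r * ((k + r) * s) + (k + r) * s                   ≡⟨ regroup₃ r k s ⟩
      suc r * (k * s) + suc r * (r * s)                 ≤⟨ +-monoˡ-≤ _ (*-monoʳ-≤ (suc r) ks≤) ⟩
      suc r * (N + m * h (suc r) k) + suc r * (r * s)   ≡⟨ regroup₄ r N m (h (suc r) k) s ⟩
      suc r * (N + r * s) + m * (suc r * h (suc r) k)   ≡⟨ cong (λ x → suc r * (N + r * s) + m * x) (h-absorb r k) ⟩
      suc r * (N + r * s) + m * ((k + r) * h r k)       ≡⟨ cong (suc r * (N + r * s) +_) (regroup₅ (k + r) m (h r k)) ⟩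
      suc r * (N + r * s) + (k + r) * (m * h r k)       ≤⟨ +-monoʳ-≤ _ (*-monoʳ-≤ (k + r) low) ⟩
      suc r * (N + r * s) + (k + r) * s                 ∎)

  -- Transfer of the bound to rational numbers.

  module Rational where
    open import Data.Integer as ℤ using (+_)
    import Data.Integer.Properties as ℤₚ
    import Data.Rational as ℚ
    open ℚ using (ℚ; 0ℚ; 1ℚ; _/_; toℚᵘ)
    import Data.Rational.Properties as ℚₚ
    open import Data.Rational.Solver using (module +-*-Solver)
    open +-*-Solver using (solve; _:*_; _:=_)
    import Data.Rational.Unnormalised as ℚᵘ
    import Data.Rational.Unnormalised.Properties as ℚᵘₚ

    ι : ℕ → ℚ
    ι n = + n / 1

    -- Fractions are stored in lowest terms. Passing to unnormalised ones removes the gcd and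
    -- reduces the identities below to integer arithmetic.
    toℚᵘ-/ : ∀ n d → toℚᵘ (+ n / suc d) ℚᵘ.≃ ℚᵘ.mkℚᵘ (+ n) d
    toℚᵘ-/ n d = ℚₚ.toℚᵘ-fromℚᵘ (ℚᵘ.mkℚᵘ (+ n) d)

    ι-+ : ∀ a b → ι (a + b) ≡ ι a ℚ.+ ι b
    ι-+ a b = ℚₚ.toℚᵘ-injective (begin-equality
      toℚᵘ (ι (a + b))                                ≃⟨ toℚᵘ-/ (a + b) 0 ⟩
      ℚᵘ.mkℚᵘ (+ (a + b)) 0
        ≃⟨ ℚᵘ.*≡* (cong (ℤ._* + 1) (trans (ℤₚ.pos-+ a b) (sym (cong₂ ℤ._+_ (ℤₚ.*-identityʳ (+ a)) (ℤₚ.*-identityʳ (+ b)))))) ⟩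
      ℚᵘ.mkℚᵘ (+ a) 0 ℚᵘ.+ ℚᵘ.mkℚᵘ (+ b) 0            ≃⟨ ℚᵘₚ.+-cong (toℚᵘ-/ a 0) (toℚᵘ-/ b 0) ⟨
      toℚᵘ (ι a) ℚᵘ.+ toℚᵘ (ι b)                      ≃⟨ ℚₚ.toℚᵘ-homo-+ (ι a) (ι b) ⟨
      toℚᵘ (ι a ℚ.+ ι b)                              ∎)
      where open ℚᵘₚ.≤-Reasoning

    ι-* : ∀ a b → ι (a * b) ≡ ι a ℚ.* ι b
    ι-* a b = ℚₚ.toℚᵘ-injective (begin-equality
      toℚᵘ (ι (a * b))                                ≃⟨ toℚᵘ-/ (a * b) 0 ⟩
      ℚᵘ.mkℚᵘ (+ (a * b)) 0                           ≃⟨ ℚᵘ.*≡* (cong (ℤ._* + 1) (ℤₚ.pos-* a b)) ⟩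
      ℚᵘ.mkℚᵘ (+ a) 0 ℚᵘ.* ℚᵘ.mkℚᵘ (+ b) 0            ≃⟨ ℚᵘₚ.*-cong (toℚᵘ-/ a 0) (toℚᵘ-/ b 0) ⟨
      toℚᵘ (ι a) ℚᵘ.* toℚᵘ (ι b)                      ≃⟨ ℚₚ.toℚᵘ-homo-* (ι a) (ι b) ⟨
      toℚᵘ (ι a ℚ.* ι b)                              ∎)
      where open ℚᵘₚ.≤-Reasoning

    ι-^ : ∀ a n → ι (a ^ n) ≡ ι a ^ℚ n
    ι-^ a zero    = refl
    ι-^ a (suc n) = trans (ι-* a (a ^ n)) (cong (ι a ℚ.*_) (ι-^ a n))

    ι-< : ∀ {a b} → a < b → ι a ℚ.< ι b
    ι-< {a} {b} a<b = ℚₚ.toℚᵘ-cancel-< (begin-strict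
      toℚᵘ (ι a)        ≃⟨ toℚᵘ-/ a 0 ⟩
      ℚᵘ.mkℚᵘ (+ a) 0   <⟨ ℚᵘ.*<* (ℤₚ.*-monoʳ-<-pos (+ 1) (ℤ.+<+ a<b)) ⟩
      ℚᵘ.mkℚᵘ (+ b) 0   ≃⟨ toℚᵘ-/ b 0 ⟨
      toℚᵘ (ι b)        ∎)
      where open ℚᵘₚ.≤-Reasoning

    /-*-ι : ∀ a d → (+ a / suc d) ℚ.* ι (suc d) ≡ ι a
    /-*-ι a d = ℚₚ.toℚᵘ-injective (begin-equality
      toℚᵘ ((+ a / suc d) ℚ.* ι (suc d))          ≃⟨ ℚₚ.toℚᵘ-homo-* (+ a / suc d) (ι (suc d)) ⟩
      toℚᵘ (+ a / suc d) ℚᵘ.* toℚᵘ (ι (suc d))    ≃⟨ ℚᵘₚ.*-cong (toℚᵘ-/ a d) (toℚᵘ-/ (suc d) 0) ⟩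
      ℚᵘ.mkℚᵘ (+ a) d ℚᵘ.* ℚᵘ.mkℚᵘ (+ suc d) 0
        ≃⟨ ℚᵘ.*≡* (trans (ℤₚ.*-identityʳ _) (cong (λ e → + a ℤ.* + e) (sym (*-identityʳ (suc d))))) ⟩
      ℚᵘ.mkℚᵘ (+ a) 0                             ≃⟨ toℚᵘ-/ a 0 ⟨
      toℚᵘ (ι a)                                  ∎)
      where open ℚᵘₚ.≤-Reasoning

    ^ℚ-*-distrib : ∀ a b n → (a ℚ.* b) ^ℚ n ≡ a ^ℚ n ℚ.* b ^ℚ n
    ^ℚ-*-distrib a b zero    = refl
    ^ℚ-*-distrib a b (suc n) = trans (cong (a ℚ.* b ℚ.*_) (^ℚ-*-distrib a b n)) (interchange a b (a ^ℚ n) (b ^ℚ n))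
      where
      interchange : ∀ a b c d → a ℚ.* b ℚ.* (c ℚ.* d) ≡ a ℚ.* c ℚ.* (b ℚ.* d)
      interchange = solve 4 (λ a b c d → (a :* b) :* (c :* d) := (a :* c) :* (b :* d)) refl

    -- Multiplication by (r + 1)^r clears the powers of r / (r + 1), and both sides become images of
    -- natural numbers.
    bound-ℚ : ∀ r m s N → r ! * (r ^ r * s ^ suc r) < m * (suc r * (N + r * s)) ^ r →
      ι (r !) ℚ.* ((+ r / suc r) ^ℚ r ℚ.* ι s ^ℚ suc r) ℚ.< ι m ℚ.* (ι N ℚ.+ ι r ℚ.* ι s) ^ℚ r
    bound-ℚ r m s N lt = ℚₚ.*-cancelʳ-<-nonNeg (ι (suc r ^ r)) {{ι-nonNegative (suc r ^ r)}} (begin-strict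
      ι (r !) ℚ.* (q ^ℚ r ℚ.* ι s ^ℚ suc r) ℚ.* ι (suc r ^ r)    ≡⟨ regroup (ι (r !)) (q ^ℚ r) (ι s ^ℚ suc r) (ι (suc r ^ r)) ⟩
      ι (r !) ℚ.* (q ^ℚ r ℚ.* ι (suc r ^ r) ℚ.* ι s ^ℚ suc r)    ≡⟨ cong₂ (λ a b → ι (r !) ℚ.* (a ℚ.* b)) cleared (sym (ι-^ s (suc r))) ⟩
      ι (r !) ℚ.* (ι (r ^ r) ℚ.* ι (s ^ suc r))
        ≡⟨ trans (cong (ι (r !) ℚ.*_) (sym (ι-* (r ^ r) (s ^ suc r)))) (sym (ι-* (r !) (r ^ r * s ^ suc r))) ⟩
      ι (r ! * (r ^ r * s ^ suc r))                              <⟨ ι-< lt ⟩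
      ι (m * (suc r * (N + r * s)) ^ r)                          ≡⟨ cong (λ x → ι (m * x)) (power-*-distrib (suc r) (N + r * s) r) ⟩
      ι (m * (suc r ^ r * (N + r * s) ^ r))
        ≡⟨ trans (ι-* m (suc r ^ r * (N + r * s) ^ r)) (cong (ι m ℚ.*_) (ι-* (suc r ^ r) ((N + r * s) ^ r))) ⟩
      ι m ℚ.* (ι (suc r ^ r) ℚ.* ι ((N + r * s) ^ r))            ≡⟨ cong (λ x → ι m ℚ.* (ι (suc r ^ r) ℚ.* x)) sum-power ⟩
      ι m ℚ.* (ι (suc r ^ r) ℚ.* (ι N ℚ.+ ι r ℚ.* ι s) ^ℚ r)     ≡⟨ regroup₂ (ι m) (ι (suc r ^ r)) ((ι N ℚ.+ ι r ℚ.* ι s) ^ℚ r) ⟩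
      ι m ℚ.* (ι N ℚ.+ ι r ℚ.* ι s) ^ℚ r ℚ.* ι (suc r ^ r)       ∎)
      where
      open ℚₚ.≤-Reasoning
      q = + r / suc r
      ι-nonNegative : ∀ n → ℚ.NonNegative (ι n)
      ι-nonNegative n = ℚ.nonNegative (ι-≤ n)
        where
        ι-≤ : ∀ n → 0ℚ ℚ.≤ ι n
        ι-≤ zero    = ℚₚ.≤-refl
        ι-≤ (suc n) = ℚₚ.<⇒≤ (ι-< {0} {suc n} (s≤s z≤n))
      regroup : ∀ f a b c → f ℚ.* (a ℚ.* b) ℚ.* c ≡ f ℚ.* (a ℚ.* c ℚ.* b)
      regroup = solve 4 (λ f a b c → (f :* (a :* b)) :* c := f :* ((a :* c) :* b)) refl
      regroup₂ : ∀ a b c → a ℚ.* (b ℚ.* c) ≡ a ℚ.* c ℚ.* b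
      regroup₂ = solve 3 (λ a b c → a :* (b :* c) := (a :* c) :* b) refl
      cleared : q ^ℚ r ℚ.* ι (suc r ^ r) ≡ ι (r ^ r)
      cleared = trans (cong (q ^ℚ r ℚ.*_) (ι-^ (suc r) r)) (trans (sym (^ℚ-*-distrib q (ι (suc r)) r))
        (trans (cong (_^ℚ r) (/-*-ι r r)) (sym (ι-^ r r))))
      sum-power : ι ((N + r * s) ^ r) ≡ (ι N ℚ.+ ι r ℚ.* ι s) ^ℚ r
      sum-power = trans (ι-^ (N + r * s) r) (cong (_^ℚ r) (trans (ι-+ N (r * s)) (cong (ι N ℚ.+_) (ι-* r s))))

    -- With a positive base, the comparison of r-th powers is equivalent to the comparison of r-th
    -- roots.
    positive-ℚ : ∀ r s N → 1 ≤ r → 1 ≤ s → 0ℚ ℚ.< ι N ℚ.+ ι r ℚ.* ι s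
    positive-ℚ r s N 1≤r 1≤s = subst (0ℚ ℚ.<_) (trans (ι-+ N (r * s)) (cong (ι N ℚ.+_) (ι-* r s)))
      (ι-< (≤-trans (*-positive 1≤r 1≤s) (m≤n+m _ N)))

-- Divisibility of the determinant by a power of p.

module Divisibility where

  open AlternatingForms
  open Exponents using (Exponent; h; nonMultiples; gap; gap-nonMultiples)
  open LatticeReduction
  open MonomialOrder
  open Taylor
  open LocalCoordinate
  open import Data.Nat as ℕ using (ℕ; suc; _≤_; _<_; s≤s; z≤n)
  import Data.Nat.Properties as ℕₚ
  import Data.Nat.Divisibility as ℕ∣
  open import Data.Nat.Primality using (Prime)
  open import Data.Integer as ℤ using (ℤ; +_; -_; ∣_∣; _+_; _*_; _-_; _^_; 0ℤ; 1ℤ)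
  import Data.Integer.Properties as ℤₚ
  open import Data.Integer.Divisibility.Signed as ℤ∣ using (_∣_; divides; _∣?_; ∣⇒∣ᵤ)
  open import Data.Integer.Tactic.RingSolver using (solve-∀)
  open import Data.Vec using (lookup; sum; tabulate)
  open import Data.Vec.Properties using (lookup∘tabulate)
  open import Data.Vec.Relation.Unary.All using (All)
  import Data.Vec.Relation.Unary.All.Properties as Allₚ
  open import Data.Vec.Functional.Properties using (insertAt-lookup; insertAt-punchIn)
  open import Relation.Nullary using (¬?)

  module Determinant
    {n : ℕ} {w : Exps (suc n)} {d : ℕ} {p : ℕ} (p-prime : Prime p)
    {f : Poly (suc n)} (f-homogeneous : WHomog w d f)
    {P : Fin (suc n) → ℤ} (j : Fin (suc n)) (wj≡1 : w j ≡ 1) (P-unit : ¬ (P j ≡ + 0 [mod p ]))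
    {m : ℕ} (α* : Exps (suc n)) (α*j≡0 : α* j ≡ 0) (degree : tdeg α* ≡ m)
    (hasse-unit : ¬ (hasseEval f α* P ≡ + 0 [mod p ]))
    {s : ℕ} (ξ : Fin s → Fin (suc n) → ℤ) (vanishes : ∀ l → eval f (ξ l) ≡ + 0)
    (reduces : ∀ l → ReducesTo w p (ξ l) P) (k : ℕ)
    where

    open Units p p-prime

    π : ℤ
    π = + p

    local : ∀ l → LocalCoordinates w (π ^ suc k) j P (ξ l)
    local l = localCoordinates k wj≡1 (P-unit ∘ ∣⇒mod) (reduces l)

    module Local l = LocalCoordinates (local l)

    module K = Congruence (π ^ suc k)

    α*′ : Exponent n
    α*′ = tabulate (α* ∘ punchIn j)

    sum-α*′ : sum α*′ ≡ m
    sum-α*′ = trans (sum-tabulate (α* ∘ punchIn j))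
      (trans (sym (trans (Σℕ-punchIn n j α*) (cong (ℕ._+ Σℕ n (α* ∘ punchIn j)) α*j≡0))) degree)

    embed-α*′ : ∀ i → embed j α*′ i ≡ α* i
    embed-α*′ i with punchIn-cases j i
    ... | inj₁ refl       = trans (insertAt-lookup (lookup α*′) j 0) (sym α*j≡0)
    ... | inj₂ (i′ , refl) = trans (insertAt-punchIn (lookup α*′) j 0 i′) (lookup∘tabulate (α* ∘ punchIn j) i′)

    -- `E` exceeds the exponents of `f`, so that the Taylor expansion over the box is complete, and
    -- the entries of `α*′`, so that this exponent competes in the box.
    bounds : ∃[ E ] (suc (Σℕ n (α* ∘ punchIn j)) ≤ E × Below E f)
    bounds = below-some f (suc (Σℕ n (α* ∘ punchIn j)))

    E : ℕ
    E = proj₁ bounds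

    instance
      E-nonZero : ℕ.NonZero E
      E-nonZero = ℕ.>-nonZero (ℕₚ.≤-trans (s≤s z≤n) (proj₁ (proj₂ bounds)))

      W-nonZero : ℕ.NonZero (2 ℕ.* E ℕ.^ n)
      W-nonZero = ℕₚ.m*n≢0 2 (E ℕ.^ n) {{_}} {{ℕₚ.m^n≢0 E n}}

    α*′-below : All (_< E) α*′
    α*′-below = Allₚ.tabulate⁺ λ i → ℕₚ.≤-trans (s≤s (≤Σℕ (α* ∘ punchIn j) i)) (proj₁ (proj₂ bounds))

    c : Exponent n → ℤ
    c α = hasseEval f (embed j α) P

    -- The exponent witnessing the multiplicity has a unit coefficient, so the lightest such
    -- exponent weighs no more. Since weight compares degrees first, its degree is at most `m`.
    leading-exponent : ∃[ α₀ ] (α₀ ∈ box n E × Unit (c α₀) × weight E α₀ ≤ weight E α*′ ×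
                                (∀ α → α ∈ box n E → Unit (c α) → weight E α₀ ≤ weight E α))
    leading-exponent = minimal (λ α → ¬? (π ∣? c α)) (weight E) (∈-box⁺ α*′-below)
      (hasse-unit ∘ ∣⇒mod ∘ subst (π ∣_) (hasseEval-cong f P embed-α*′))

    α₀ : Exponent n
    α₀ = proj₁ leading-exponent

    α₀∈ : α₀ ∈ box n E
    α₀∈ = proj₁ (proj₂ leading-exponent)

    sum-α₀ : sum α₀ ≤ m
    sum-α₀ = subst (sum α₀ ≤_) sum-α*′ (weight-≤⇒sum-≤ {α = α₀} α*′-below (proj₁ (proj₂ (proj₂ (proj₂ leading-exponent)))))

    -- A unit coefficient at another exponent cannot tie with the minimum, because the weight is
    -- injective on the box.
    leading : ∀ α → α ∈ box n E → α ≢ α₀ → π ∣ c α ⊎ weight E α₀ < weight E α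
    leading α α∈ α≢ with π ∣? c α
    ... | yes d = inj₁ d
    ... | no  u = inj₂ (ℕₚ.≤∧≢⇒< (proj₂ (proj₂ (proj₂ (proj₂ leading-exponent))) α α∈ u)
        λ eq → α≢ (weight-injective (∈-box⁻ α∈) (∈-box⁻ α₀∈) (sym eq)))

    weaken : ∀ {a} → π ^ suc k ∣ a → π ^ k ∣ a
    weaken = ℤ∣.∣-trans (divides π refl)

    -- By weighted homogeneity `f` vanishes at the rescaled tuple μ^(w i) ξ_i. `point` is congruent
    -- to that tuple, and the left side is the Taylor expansion of `f` there.
    relation : ∀ l → π ^ k ∣ sumOver (box n E) (λ α → c α * monomial α (λ i → π * Local.y l i))
    relation l = weaken (K.≈0⇒divisible (K.≈-trans
      (K.≈-reflexive (sym (taylor E j f P (Local.point l) (λ i → π * Local.y l i) (proj₂ (proj₂ bounds))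
        (insertAt-lookup _ j (P j)) (insertAt-punchIn _ j (P j)))))
      (K.≈-trans (K.eval-cong f (Local.point-≈ l))
        (K.≈-reflexive (trans (weighted-eval f-homogeneous (Local.μ l) (ξ l))
          (trans (cong (Local.μ l ^ d *_) (vanishes l)) (ℤₚ.*-zeroʳ (Local.μ l ^ d))))))))

    -- `e` is the common weighted degree of the monomials. It fixes the factor ν^e in the
    -- generators, so that one lattice serves all rows of the matrix.
    module _ (e : ℕ) where

      open Reduction π k Local.y (λ l → Local.ν l ^ e) (box n E) (box-unique n E) c relation α₀ α₀∈
        (proj₁ (inverse k (proj₁ (proj₂ (proj₂ leading-exponent)))))
        (proj₂ (inverse k (proj₁ (proj₂ (proj₂ leading-exponent)))))
        (weight E) (2 ℕ.* E ℕ.^ n) (weight-⊕ E) (weight-bound E) leading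
      open LatticeClosure π k {s}

      -- Up to a multiple of π^k the value at `ξ l` is ν^e times the value at `point`, because νμ =
      -- 1 modulo p^(k + 1). The latter value expands into the rows ν^e z^α, with coefficients that
      -- are the same for all `l`.
      monoEval-∈ : ∀ (β : Exps (suc n)) → wdeg w β ≡ e → InLattice T (λ l → monoEval β (ξ l))
      monoEval-∈ β wβ≡e = cong-∈ T (λ l → split-off (monoEval β (ξ l)) (Local.ν l ^ e * monoEval β (Local.point l)))
        (linear-∈ T 1ℤ point-∈ (divisible-∈ T λ l → weaken (K.difference (ξ≈ l))))
        where
        split-off : ∀ a b → a ≡ b + 1ℤ * (a + - b)
        split-off = solve-∀
        ξ≈ : ∀ l → monoEval β (ξ l) K.≈ Local.ν l ^ e * monoEval β (Local.point l)
        ξ≈ l = K.≈-sym (K.≈-trans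
          (K.*-cong (K.≈-refl {Local.ν l ^ e}) (K.≈-trans (K.monoEval-cong β (Local.point-≈ l))
            (K.≈-reflexive (trans (weighted-monoEval w β (Local.μ l) (ξ l)) (cong (λ a → Local.μ l ^ a * monoEval β (ξ l)) wβ≡e)))))
          (K.≈-trans (K.≈-reflexive (trans (sym (ℤₚ.*-assoc (Local.ν l ^ e) (Local.μ l ^ e) _))
              (cong (_* monoEval β (ξ l)) (sym (^-*-distrib (Local.ν l) (Local.μ l) e)))))
            (K.≈-trans (K.*-cong (K.one-^ e (Local.νμ l)) (K.≈-refl {monoEval β (ξ l)}))
              (K.≈-reflexive (ℤₚ.*-identityˡ _)))))
        -- `β` is unrelated to `f`, so its expansion uses a box of its own; `row-∈` covers exponents
        -- outside the box of the relation.
        Eβ : ℕ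
        Eβ = suc (Σℕ (suc n) β)
        coefficient : Exponent n → ℤ
        coefficient α = hasseMonomial β (embed j α) P
        pull : ∀ a b c → a * (b * c) ≡ 0ℤ + b * (a * c)
        pull = solve-∀
        point-∈ : InLattice T (λ l → Local.ν l ^ e * monoEval β (Local.point l))
        point-∈ = cong-∈ T
          (λ l → trans (cong (Local.ν l ^ e *_)
              (taylor-monomial Eβ j β P (Local.point l) (λ i → π * Local.y l i) (s≤s ∘ ≤Σℕ β)
                (insertAt-lookup _ j (P j)) (insertAt-punchIn _ j (P j))))
            (sym (sumOver-* (box n Eβ) (Local.ν l ^ e) (λ α → coefficient α * monomial α (z l)))))
          (sumOver-∈ T (box n Eβ) λ α _ →
            cong-∈ T (λ l → pull (Local.ν l ^ e) (coefficient α) (monomial α (z l)))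
              (linear-∈ T (coefficient α) (zero-∈ T) (row-∈ α)))

      -- With n = r + 1 affine coordinates the gaps sum to at most `m * h n k`, that is m C(k + r, r
      -- + 1).
      determinant-divisible : ∀ (M : Fin s → Exps (suc n)) → (∀ i → wdeg w (M i) ≡ e) →
        ∀ N → N ℕ.+ m ℕ.* h n k ≤ k ℕ.* s → (p ℕ.^ N) ℕ∣.∣ ∣ det s (λ i l → monoEval (M i) (ξ l)) ∣
      determinant-divisible M wM N bound = subst₂ ℕ∣._∣_ (abs-^ p N)
        (cong ∣_∣ (det-cong s λ i l → cong (λ x → x l) (lookup∘tabulate rows i)))
        (∣⇒∣ᵤ (alternating-divisible T s (det-alternating s (λ l → l)) (Allₚ.tabulate⁺ λ i → monoEval-∈ (M i) (wM i)) N
          (ℕₚ.≤-trans (ℕₚ.+-monoʳ-≤ N (begin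
            deficit T                  ≡⟨ deficit-map (nonMultiples α₀ k) ⟩
            gap k (nonMultiples α₀ k)  ≤⟨ gap-nonMultiples α₀ k ⟩
            sum α₀ ℕ.* h n k           ≤⟨ ℕₚ.*-monoˡ-≤ (h n k) sum-α₀ ⟩
            m ℕ.* h n k                ∎)) bound)))
        where
        open ℕₚ.≤-Reasoning
        rows : Fin s → Row s
        rows i l = monoEval (M i) (ξ l)

-- Assembly of divisibility and estimates.

open import Data.Nat as ℕ using (ℕ; zero; suc; _≤_; _^_; _!)
open import Data.Nat.Divisibility using (_∣_; 1∣_)
open import Data.Nat.Primality using (Prime)
open import Data.Nat.GCD using (gcd)
open import Data.Integer as ℤ using (ℤ; +_; ∣_∣)
open import Data.Rational using (0ℚ; _/_; _+_; _*_; _<_)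
open import Data.Nat.Properties using (≤-total; ≤-reflexive; n≤0⇒n≡0; m∸n+n≡m; m≤n⇒m∸n≡0; +-comm; m≤n+m∸n)
import Data.Rational.Properties as ℚₚ
open Exponents using (h)
open LocalCoordinate
open Taylor
open Divisibility
open Estimates
open Rational

chart-weight : ∀ {r} {w : Fin (suc (suc r)) → ℕ} → w zero ≡ 1 → w (suc zero) ≡ 1 → ∀ k → w (chart k) ≡ 1
chart-weight w₀ w₁ zero    = w₀
chart-weight w₀ w₁ (suc _) = w₁

-- For m = 0 the witness would be the zero exponent, whose Hasse derivative is f(P), and this is
-- zero modulo `p`.
multiplicity-positive : ∀ {r p m} (f : Poly (suc (suc r))) P → eval f P ≡ + 0 [mod p ] → IsMultiplicity f p P m → 1 ≤ m
multiplicity-positive {m = suc m} _ _ _ _ = ℕ.s≤s ℕ.z≤n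
multiplicity-positive {m = zero} f P on-f (_ , _ , _ , α , _ , degree , unit) =
  contradiction (subst (_≡ + 0 [mod _ ]) (trans (sym (hasseEval-zero f P)) (hasseEval-cong f P λ i → sym (vanish i))) on-f) unit
  where
  vanish : ∀ i → α i ≡ 0
  vanish i = n≤0⇒n≡0 (subst (α i ≤_) degree (≤Σℕ α i))

determinant-bound : ∀ {r} → 1 ≤ r →
  ∀ {w d p} → w zero ≡ 1 → w (suc zero) ≡ 1 → Prime p →
  ∀ (f : Poly (suc (suc r))) → WHomog w d f → ∀ P → eval f P ≡ + 0 [mod p ] →
  ∀ {m} → IsMultiplicity f p P m → ∀ {s} → 1 ≤ s →
  ∀ {ξ : Fin s → Fin (suc (suc r)) → ℤ} → (∀ l → eval f (ξ l) ≡ + 0) → (∀ l → ReducesTo w p (ξ l) P) →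
  ∀ (M : Fin s → Exps (suc (suc r))) → ∃[ e ] (∀ j → wdeg w (M j) ≡ e) →
  ∃[ N ] ((p ^ N) ∣ ∣ det s (λ j l → monoEval (M j) (ξ l)) ∣ × 0ℚ < ι N + ι r * ι s ×
    ι (r !) * ((+ r / suc r) ^ℚ r * ι s ^ℚ suc r) < ι m * (ι N + ι r * ι s) ^ℚ r)
determinant-bound {r} 1≤r {w} {p = p} w₀ w₁ p-prime f hom P on-f {m} mult@(j , P-unit , _ , α , αj≡0 , degree , unit)
                  {s} 1≤s {ξ} vanishes reduces M (e , wM)
  with k , low , high ← optimal-degree r m s 1≤r (multiplicity-positive f P on-f mult) =
  N , divisible , positive-ℚ r s N 1≤r 1≤s , bound-ℚ r m s N (bound-ℕ r m s k N 1≤r 1≤s low high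
    (subst (k ℕ.* s ≤_) (+-comm loss N) (m≤n+m∸n (k ℕ.* s) loss)))
  where
  loss = m ℕ.* h (suc r) k
  -- The subtraction is truncated: if the loss exceeds k s, then N = 0 and divisibility is trivial,
  -- while the inequality k s ≤ N + loss used in the estimate holds in both cases.
  N = k ℕ.* s ℕ.∸ loss
  divisible : p ^ N ∣ ∣ det s (λ j l → monoEval (M j) (ξ l)) ∣
  divisible with ≤-total loss (k ℕ.* s)
  ... | inj₁ loss≤ = Determinant.determinant-divisible p-prime hom (chart j) (chart-weight {w = w} w₀ w₁ j) P-unit α αj≡0 degree unit
      ξ vanishes reduces k e M wM N (≤-reflexive (m∸n+n≡m loss≤))
  ... | inj₂ ≤loss = subst (λ N → p ^ N ∣ ∣ det s (λ j l → monoEval (M j) (ξ l)) ∣) (sym (m≤n⇒m∸n≡0 ≤loss)) (1∣ _)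

theorem4p1 : (∀ (d r : ℕ) → 1 ≤ r → ∃[ κ ] (0ℚ < κ ×
    (∀ (w : Fin (suc (suc r)) → ℕ) → w zero ≡ 1 → w (suc zero) ≡ 1 → (∀ i → 1 ≤ w i) →
    ∀ (p : ℕ) → Prime p →
    ∀ (f : Poly (suc (suc r))) → WHomog w d f →
    ∀ (P : Fin (suc (suc r)) → ℤ) → FpPoint p P → eval f P ≡ + 0 [mod p ] →
    ∀ (m : ℕ) → IsMultiplicity f p P m →
    ∀ (s : ℕ) → 1 ≤ s →
    ∀ (ξ : Fin s → Fin (suc (suc r)) → ℤ) →
    (∀ l l′ → l ≢ l′ → ∃[ i ] ξ l i ≢ ξ l′ i) →
    (∀ l → Primitive (ξ l)) →
    (∀ l → eval f (ξ l) ≡ + 0) →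
    (∀ l → ReducesTo w p (ξ l) P) →
    (∀ l → gcd ∣ ξ l zero ∣ ∣ ξ l (suc zero) ∣ ≡ 1) →
    ∀ (M : Fin s → Exps (suc (suc r))) → (∃[ e ] (∀ j → wdeg w (M j) ≡ e)) →
    ∃[ N ] ((p ^ N) ∣ ∣ det s (λ j l → monoEval (M j) (ξ l)) ∣ ×
    (0ℚ < ((+ N / 1) + (κ * (+ s / 1)))) ×
    (((+ (r !) / 1) * (((+ r / suc r) ^ℚ r) * ((+ s / 1) ^ℚ suc r)))
    < ((+ m / 1) * (((+ N / 1) + (κ * (+ s / 1))) ^ℚ r)))))))
    ×
    (∀ (r : ℕ) → 1 ≤ r → ∃[ κ′ ] (0ℚ < κ′ ×
    (∀ (d : ℕ) →
    ∀ (w : Fin (suc (suc r)) → ℕ) → w zero ≡ 1 → w (suc zero) ≡ 1 → (∀ i → 1 ≤ w i) →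
    ∀ (p : ℕ) → Prime p →
    ∀ (f : Poly (suc (suc r))) → WHomog w d f →
    ∀ (P : Fin (suc (suc r)) → ℤ) → FpPoint p P → eval f P ≡ + 0 [mod p ] →
    IsMultiplicity f p P 1 →
    ∀ (s : ℕ) → 1 ≤ s →
    ∀ (ξ : Fin s → Fin (suc (suc r)) → ℤ) →
    (∀ l l′ → l ≢ l′ → ∃[ i ] ξ l i ≢ ξ l′ i) →
    (∀ l → Primitive (ξ l)) →
    (∀ l → eval f (ξ l) ≡ + 0) →
    (∀ l → ReducesTo w p (ξ l) P) →
    (∀ l → gcd ∣ ξ l zero ∣ ∣ ξ l (suc zero) ∣ ≡ 1) →
    ∀ (M : Fin s → Exps (suc (suc r))) → (∃[ e ] (∀ j → wdeg w (M j) ≡ e)) →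
    ∃[ N ] ((p ^ N) ∣ ∣ det s (λ j l → monoEval (M j) (ξ l)) ∣ ×
    (0ℚ < ((+ N / 1) + (κ′ * (+ s / 1)))) ×
    (((+ (r !) / 1) * (((+ r / suc r) ^ℚ r) * ((+ s / 1) ^ℚ suc r)))
    < (((+ N / 1) + (κ′ * (+ s / 1))) ^ℚ r))))))
theorem4p1 =
  (λ d r 1≤r → ι r , ι-< 1≤r , λ w w₀ w₁ _ p p-prime f hom P _ on-f m mult s 1≤s ξ _ _ vanishes reduces _ M degrees →
    determinant-bound 1≤r {w} w₀ w₁ p-prime f hom P on-f mult 1≤s vanishes reduces M degrees) ,
  -- The same constant serves, being chosen before `d`; for multiplicity 1 the factor `ι 1` is the
  -- rational unit and is cancelled.
  (λ r 1≤r → ι r , ι-< 1≤r , λ d w w₀ w₁ _ p p-prime f hom P _ on-f mult s 1≤s ξ _ _ vanishes reduces _ M degrees →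
    let N , divisible , positive , bound = determinant-bound 1≤r {w} w₀ w₁ p-prime f hom P on-f mult 1≤s vanishes reduces M degrees
    in N , divisible , positive , subst (_ <_) (ℚₚ.*-identityˡ ((ι N + ι r * ι s) ^ℚ r)) bound)
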